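{- For integers $s,t\ge 2$, \[ R^3(BK_s, BK_t) = \begin{cases} t+s-1 & \text{if } s=t=2,\ s=t=3,\ \{s,t\}=\{2,3\} \text{ or } \{s,t\}=\{2,4\},\\ t+s-2 & \text{if } s=2,\ t\ge 5, \text{ or } s=3,\ t\ge 4, \text{ or } s=t=4,\\ t+s-3 & \text{if } s\ge 4 \text{ and } t\ge 5. \end{cases} \]
   Context: For a graph $G=(V,E)$ and an integer $r\ge 2$, $BG$ (the set of Berge copies of $G$) is the set of $r$-uniform hypergraphs $\mathcal{H}'$ for which there exist an injection $\phi: V\to V(\mathcal{H}')$ and a bijection $\psi: E\to E(\mathcal{H}')$ such that $\{\phi(u),\phi(v)\}\subseteq \psi(uv)$ for every edge $uv\in E$. $K_n$ denotes the complete graph on $n$ vertices. For collections $\mathcal{F}_1,\mathcal{F}_2$ of $r$-uniform hypergraphs, the Ramsey number $R^r(\mathcal{F}_1,\mathcal{F}_2)$ is the least $N$ such that in every coloring of the hyperedges of the complete $r$-uniform hypergraph on $N$ vertices with two colors (first and second color), there is a subhypergraph all of whose hyperedges have the first color and which is isomorphic to a member of $\mathcal{F}_1$, or one all of whose hyperedges have the second color and which is isomorphic to a member of $\mathcal{F}_2$. Here $r=3$. -}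

module Defs where

open import Data.Nat using (ℕ; _+_; _∸_; _≤_; _<_)
open import Data.Fin using (Fin) renaming (_<_ to _<ᶠ_)
open import Data.Bool using (Bool; true; false)
open import Data.Product using (Σ; _×_; _,_; ∃; ∃-syntax; proj₁)
open import Data.Sum using (_⊎_)
open import Relation.Binary.PropositionalEquality using (_≡_)
open import Relation.Nullary using (¬_)

-- Hyperedges of the complete 3-uniform hypergraph K_N^(3) on vertex set Fin N:
-- 3-element subsets {a,b,c}, represented uniquely as triples with a < b < c.
Triple : ℕ → Set
Triple N = Σ (Fin N × Fin N × Fin N) λ { (a , b , c) → (a <ᶠ b) × (b <ᶠ c) }

_∈ₑ_ : ∀ {N} → Fin N → Triple N → Set
v ∈ₑ ((a , b , c) , _) = (v ≡ a) ⊎ (v ≡ b) ⊎ (v ≡ c)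

-- Edges of the complete graph K_s on Fin s: pairs i < j.
Pair : ℕ → Set
Pair s = Σ (Fin s × Fin s) λ { (i , j) → i <ᶠ j }

-- A 2-colouring of the hyperedges of K_N^(3); colour true = first, false = second.
Colouring : ℕ → Set
Colouring N = Triple N → Bool

-- There is a subhypergraph of K_N^(3), all of whose hyperedges have colour κ,
-- which is a Berge copy of K_s: an injection φ on vertices and an injection ψ
-- from edges of K_s to hyperedges (a bijection onto its image, the edge set of
-- the subhypergraph) with {φ i, φ j} ⊆ ψ(ij).
MonoBergeK : (N : ℕ) → Colouring N → Bool → ℕ → Set
MonoBergeK N col κ s =
  Σ (Fin s → Fin N) λ φ →
  Σ (Pair s → Triple N) λ ψ →
    (∀ i j → φ i ≡ φ j → i ≡ j) ×
    (∀ p q → proj₁ (ψ p) ≡ proj₁ (ψ q) → proj₁ p ≡ proj₁ q) ×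
    (∀ (p : Pair s) → let ((i , j) , _) = p in (φ i ∈ₑ ψ p) × (φ j ∈ₑ ψ p)) ×
    (∀ p → col (ψ p) ≡ κ)

Arrows : ℕ → ℕ → ℕ → Set
Arrows N s t = (col : Colouring N) → MonoBergeK N col true s ⊎ MonoBergeK N col false t

RamseyBergeK3 : ℕ → ℕ → ℕ → Set
RamseyBergeK3 s t N = Arrows N s t × (∀ M → M < N → ¬ Arrows M s t)

{-# OPTIONS --safe #-}
module Submission where

-- Upper bounds. Delete a vertex v and let S be the core of a monochromatic Berge clique in the rest.
-- The triples at v are unused, and they extend the clique by v as soon as distinct edges of the link of v
-- in that colour can be assigned to the vertices of S. This fails only if some nonempty C ⊆ S has no such
-- link edge to its complement, i.e. if all pairs across C are link edges of the other colour. Two such cuts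
-- in opposite colours cannot coexist, so R(s, t) ≤ max (R(s - 1, t), R(s, t - 1)) + 1.
-- For s = 3 and s = 4 only the blue clique can be shrunk, and one obtains a red cut at every vertex;
-- such a family of cuts contains a red Berge K₃, resp. K₄. What remains are R(3, 4) ≤ 5 and R(4, 5) ≤ 6,
-- settled by an explicit case analysis.
--
-- Lower bounds. For |A| = s - 2 and |B| = t - 2, colour the triples in A ∪ B by whether they meet A in
-- at least two vertices. For s = 3, let the triples through a fixed pair be red. The remaining cases
-- have too few triples of either colour.

open import Defs
open import Data.Bool using (Bool; true; false; not)
import Data.Bool.Properties as Bool
open import Data.Empty using (⊥)
open import Data.Fin using (Fin; zero; suc; toℕ; fromℕ<; punchIn) renaming (_<_ to _<ᶠ_; _≤_ to _≤ᶠ_)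
open import Data.Fin.Patterns
open import Data.Fin.Properties as Fin using (_≟_; any?; all?; pigeonhole)
open import Data.Fin.Subset using (Subset; _-_; _∈_; _∉_; _⊆_; _⊂_; Nonempty)
open import Data.Fin.Subset.Induction using (Acc; acc; ⊂-wellFounded)
import Data.Fin.Subset.Properties as Subset
open import Data.List as List using (List; []; _∷_; _++_; length)
import Data.List.Membership.DecPropositional as DecMembership
open import Data.List.Membership.Propositional using () renaming (_∈_ to _∈ₗ_)
open import Data.List.Relation.Binary.Pointwise as Pointwise using (Pointwise; []; _∷_)
open import Data.List.Relation.Unary.All as All using (All; []; _∷_)
import Data.List.Relation.Unary.All.Properties as All
open import Data.List.Relation.Unary.Any as Any using (Any)
import Data.List.Relation.Unary.Any.Properties as Any
open import Data.Maybe using (just)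
open import Data.Nat using (ℕ; zero; suc; _+_; _∸_; _≤_; _<_; z≤n; s≤s; s<s; s≤s⁻¹; s<s⁻¹; _<?_; _/_; _%_; _≤′_; ≤′-refl; ≤′-step)
open import Data.Nat.DivMod using (_mod_)
import Data.Nat.Properties as ℕ
open import Data.Product as Product using (Σ; ∃; ∃-syntax; _×_; _,_; proj₁; proj₂)
import Data.Product.Properties as Product
open import Data.Sum as Sum using (_⊎_; inj₁; inj₂; [_,_]′)
open import Data.Unit using (⊤; tt)
open import Data.Vec as Vec using (Vec; []; _∷_; lookup)
import Data.Vec.Properties as Vec
open import Data.Vec.Relation.Unary.All using ([]; _∷_)
open import Data.Vec.Relation.Unary.Unique.Propositional using ([]; _∷_)
open import Data.Vec.Relation.Unary.Unique.Propositional.Properties using (lookup-injective)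
open import Function using (_∘_; id)
open import Relation.Binary.Definitions using (tri<; tri≈; tri>)
open import Relation.Binary.PropositionalEquality using (_≡_; _≢_; refl; sym; trans; cong; cong₂; subst)
open import Relation.Nullary using (¬_; Dec; yes; no; does; contradiction)
open import Relation.Nullary.Decidable using (_×-dec_; _⊎-dec_; _→-dec_; ¬?; True; toWitness; decidable-stable; dec-true; dec-false)

private
  variable
    N m k s t : ℕ
    κ : Bool
    A B : Set

-- Unordered triples and their colours

Tri : Set → Set
Tri A = A × A × A

map₃ : (A → B) → Tri A → Tri B
map₃ f (a , b , c) = f a , f b , f c

infix 4 _∈₃_ _⊑_

_∈₃_ : A → Tri A → Set
x ∈₃ (a , b , c) = (x ≡ a) ⊎ (x ≡ b) ⊎ (x ≡ c)

_⊑_ : Tri A → Tri A → Set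
(a , b , c) ⊑ t = a ∈₃ t × b ∈₃ t × c ∈₃ t

Distinct : Tri A → Set
Distinct (a , b , c) = a ≢ b × a ≢ c × b ≢ c

⊑-∈ : ∀ {x : A} {t u} → x ∈₃ t → t ⊑ u → x ∈₃ u
⊑-∈ (inj₁ refl)        (p , _ , _) = p
⊑-∈ (inj₂ (inj₁ refl)) (_ , p , _) = p
⊑-∈ (inj₂ (inj₂ refl)) (_ , _ , p) = p

⊑-trans : ∀ {t u w : Tri A} → t ⊑ u → u ⊑ w → t ⊑ w
⊑-trans (p , q , r) u⊑w = ⊑-∈ p u⊑w , ⊑-∈ q u⊑w , ⊑-∈ r u⊑w

∈₃-map : ∀ (f : A → B) {x t} → x ∈₃ t → f x ∈₃ map₃ f t
∈₃-map f = Sum.map (cong f) (Sum.map (cong f) (cong f))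

⊑-map : ∀ (f : A → B) {t u} → t ⊑ u → map₃ f t ⊑ map₃ f u
⊑-map f {t} {u} (p , q , r) = ∈₃-map f {t = u} p , ∈₃-map f {t = u} q , ∈₃-map f {t = u} r

slot : ∀ {x : A} {t} → x ∈₃ t → Fin 3
slot (inj₁ _)        = 0F
slot (inj₂ (inj₁ _)) = 1F
slot (inj₂ (inj₂ _)) = 2F

nth : Tri A → Fin 3 → A
nth (a , _ , _) 0F = a
nth (_ , b , _) 1F = b
nth (_ , _ , c) 2F = c

slot-nth : ∀ {x : A} {t} (p : x ∈₃ t) → x ≡ nth t (slot {t = t} p)
slot-nth (inj₁ eq)        = eq
slot-nth (inj₂ (inj₁ eq)) = eq
slot-nth (inj₂ (inj₂ eq)) = eq

slot-injective : ∀ {x y : A} {t} (p : x ∈₃ t) (q : y ∈₃ t) → slot {t = t} p ≡ slot {t = t} q → x ≡ y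
slot-injective {t = t} p q eq = trans (slot-nth {t = t} p) (trans (cong (nth t) eq) (sym (slot-nth {t = t} q)))

-- Together with `x`, the entries of `t` are four members of `u`, which has three slots. Two of them
-- share a slot, and as `a`, `b`, `c` differ, one of the two is `x`.
distinct-covers : ∀ {t u : Tri A} → Distinct t → t ⊑ u → ∀ {x} → x ∈₃ u → x ∈₃ t
distinct-covers {t = a , b , c} {u} (a≢b , a≢c , b≢c) (a∈ , b∈ , c∈) {x} x∈
  with pigeonhole {3} {4} (s≤s (s≤s (s≤s (s≤s z≤n)))) f
  where
  f : Fin 4 → Fin 3
  f 0F = slot {t = u} a∈
  f 1F = slot {t = u} b∈
  f 2F = slot {t = u} c∈
  f 3F = slot {t = u} x∈
... | 0F , 1F , _ , eq = contradiction (slot-injective {t = u} a∈ b∈ eq) a≢b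
... | 0F , 2F , _ , eq = contradiction (slot-injective {t = u} a∈ c∈ eq) a≢c
... | 1F , 2F , _ , eq = contradiction (slot-injective {t = u} b∈ c∈ eq) b≢c
... | 0F , 3F , _ , eq = inj₁ (sym (slot-injective {t = u} a∈ x∈ eq))
... | 1F , 3F , _ , eq = inj₂ (inj₁ (sym (slot-injective {t = u} b∈ x∈ eq)))
... | 2F , 3F , _ , eq = inj₂ (inj₂ (sym (slot-injective {t = u} c∈ x∈ eq)))
... | 1F , 1F , lt , _ = contradiction lt (ℕ.n≮n _)
... | 2F , 2F , lt , _ = contradiction lt (ℕ.n≮n _)
... | 3F , 3F , lt , _ = contradiction lt (ℕ.n≮n _)
... | 2F , 1F , s≤s () , _
... | 3F , 1F , s≤s () , _
... | 3F , 2F , s≤s (s≤s ()) , _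

distinct-⊑-sym : ∀ {t u : Tri A} → Distinct t → t ⊑ u → u ⊑ t
distinct-⊑-sym {t = t} {u} d t⊑u = cover (inj₁ refl) , cover (inj₂ (inj₁ refl)) , cover (inj₂ (inj₂ refl))
  where
  cover : ∀ {x} → x ∈₃ u → x ∈₃ t
  cover = distinct-covers d t⊑u

-- Mutual containment makes the minima and the maxima agree; the middle entry can then match only
-- the middle entry.
sorted-⊑ : ∀ (e e′ : Triple N) → proj₁ e ⊑ proj₁ e′ → proj₁ e′ ⊑ proj₁ e → proj₁ e ≡ proj₁ e′
sorted-⊑ {N} e@((a , b , c) , a<b , b<c) e′@((a′ , b′ , c′) , a′<b′ , b′<c′) e⊑e′ e′⊑e =
  cong₂ _,_ a≡a′ (cong₂ _,_ (mid (proj₁ (proj₂ e⊑e′))) c≡c′)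
  where
  lower : ∀ (e : Triple N) {x} → x ∈ₑ e → proj₁ (proj₁ e) ≤ᶠ x
  lower _ (inj₁ refl) = ℕ.≤-refl
  lower (_ , a<b , _) (inj₂ (inj₁ refl)) = ℕ.<⇒≤ a<b
  lower (_ , a<b , b<c) (inj₂ (inj₂ refl)) = ℕ.<⇒≤ (ℕ.<-trans a<b b<c)
  upper : ∀ (e : Triple N) {x} → x ∈ₑ e → x ≤ᶠ proj₂ (proj₂ (proj₁ e))
  upper (_ , a<b , b<c) (inj₁ refl) = ℕ.<⇒≤ (ℕ.<-trans a<b b<c)
  upper (_ , _ , b<c) (inj₂ (inj₁ refl)) = ℕ.<⇒≤ b<c
  upper _ (inj₂ (inj₂ refl)) = ℕ.≤-refl
  a≡a′ : a ≡ a′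
  a≡a′ = Fin.≤-antisym (lower e (proj₁ e′⊑e)) (lower e′ (proj₁ e⊑e′))
  c≡c′ : c ≡ c′
  c≡c′ = Fin.≤-antisym (upper e′ (proj₂ (proj₂ e⊑e′))) (upper e (proj₂ (proj₂ e′⊑e)))
  mid : b ∈ₑ e′ → b ≡ b′
  mid (inj₁ b≡a′)        = contradiction (trans a≡a′ (sym b≡a′)) (Fin.<⇒≢ a<b)
  mid (inj₂ (inj₁ b≡b′)) = b≡b′
  mid (inj₂ (inj₂ b≡c′)) = contradiction (trans b≡c′ (sym c≡c′)) (Fin.<⇒≢ b<c)

span-< : ∀ {a b c : Fin N} → a <ᶠ b → a ≢ c → b ≢ c → Σ (Triple N) λ e → (a , b , c) ⊑ proj₁ e
span-< {a = a} {b} {c} a<b a≢c b≢c with Fin.<-cmp b c | Fin.<-cmp a c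
... | tri≈ _ b≡c _ | _ = contradiction b≡c b≢c
... | _ | tri≈ _ a≡c _ = contradiction a≡c a≢c
... | tri< b<c _ _ | _ = ((a , b , c) , a<b , b<c) , inj₁ refl , inj₂ (inj₁ refl) , inj₂ (inj₂ refl)
... | tri> _ _ c<b | tri< a<c _ _ = ((a , c , b) , a<c , c<b) , inj₁ refl , inj₂ (inj₂ refl) , inj₂ (inj₁ refl)
... | _ | tri> _ _ c<a = ((c , a , b) , c<a , a<b) , inj₂ (inj₁ refl) , inj₂ (inj₂ refl) , inj₁ refl

span : ∀ (t : Tri (Fin N)) → Distinct t → Σ (Triple N) λ e → t ⊑ proj₁ e
span (a , b , c) (a≢b , a≢c , b≢c) with Fin.<-cmp a b
... | tri≈ _ a≡b _ = contradiction a≡b a≢b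
... | tri< a<b _ _ = span-< a<b a≢c b≢c
... | tri> _ _ b<a with e , b∈ , a∈ , c∈ ← span-< b<a b≢c a≢c = e , a∈ , b∈ , c∈

-- Membership rather than equality of triples, so that the order of the three vertices is immaterial.
Hued : Colouring N → Bool → Tri (Fin N) → Set
Hued {N} col κ t = Σ (Triple N) λ e → t ⊑ proj₁ e × col e ≡ κ

hued-⊑ : ∀ {col : Colouring N} {t u} → u ⊑ t → Hued col κ t → Hued col κ u
hued-⊑ u⊑t (e , t⊑e , ce) = e , ⊑-trans u⊑t t⊑e , ce

hued-either : ∀ (col : Colouring N) {t} → Distinct t → Hued col true t ⊎ Hued col false t
hued-either col {t} d with e , t⊑e ← span t d with col e in ce
... | true  = inj₁ (e , t⊑e , ce)
... | false = inj₂ (e , t⊑e , ce)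

-- A `Triple` carries its order proofs, and a colouring takes them as input. Such proofs are unique,
-- so the colour depends on the vertices alone.
col-cong : ∀ (col : Colouring N) e e′ → proj₁ e ≡ proj₁ e′ → col e ≡ col e′
col-cong col (_ , a<b , b<c) (_ , a<b′ , b<c′) refl =
  cong₂ (λ p q → col (_ , p , q)) (ℕ.<-irrelevant a<b a<b′) (ℕ.<-irrelevant b<c b<c′)

hued-exclusive : ∀ (col : Colouring N) {t} → Distinct t → Hued col true t → ¬ Hued col false t
hued-exclusive col d (e , t⊑e , ce) (e′ , t⊑e′ , ce′)
  with () ← trans (sym ce) (trans (col-cong col e e′ (sorted-⊑ e e′
    (⊑-trans (distinct-⊑-sym d t⊑e) t⊑e′) (⊑-trans (distinct-⊑-sym d t⊑e′) t⊑e))) ce′)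

-- Growing Berge copies vertex by vertex

Inj : ∀ {m N} → (Fin m → Fin N) → Set
Inj f = ∀ i j → f i ≡ f j → i ≡ j

noVertices : ∀ {col : Colouring N} → MonoBergeK N col κ 0
noVertices = (λ ()) , (λ ()) , (λ ()) , (λ ()) , (λ ()) , (λ ())

-- Copies are grown from the empty one by this step. The new vertex takes index 0, so `e i` serves
-- the pair of `zero` and `suc i`, and the old pairs shift up by one.
addVertex : ∀ {col : Colouring N} (K : MonoBergeK N col κ k) (v : Fin N) (e : Fin k → Triple N) →
  (∀ i → proj₁ K i ≢ v) →
  (∀ i j → proj₁ (e i) ≡ proj₁ (e j) → i ≡ j) →
  (∀ i p → proj₁ (e i) ≢ proj₁ (proj₁ (proj₂ K) p)) →
  (∀ i → v ∈ₑ e i × proj₁ K i ∈ₑ e i) →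
  (∀ i → col (e i) ≡ κ) →
  MonoBergeK N col κ (suc k)
addVertex {N} {κ} {k} {col} (φ , ψ , φ-inj , ψ-inj , ⊆ψ , colψ) v e φ≢v e-inj e≢ψ ∈e cole =
  φ′ , ψ′ , φ′-inj , ψ′-inj , ⊆ψ′ , colψ′
  where
  φ′ : Fin (suc k) → Fin N
  φ′ zero    = v
  φ′ (suc i) = φ i
  ψ′ : Pair (suc k) → Triple N
  ψ′ ((zero , suc j) , _)    = e j
  ψ′ ((suc i , suc j) , i<j) = ψ ((i , j) , s<s⁻¹ i<j)
  φ′-inj : ∀ i j → φ′ i ≡ φ′ j → i ≡ j
  φ′-inj zero    zero    _  = refl
  φ′-inj zero    (suc j) eq = contradiction (sym eq) (φ≢v j)
  φ′-inj (suc i) zero    eq = contradiction eq (φ≢v i)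
  φ′-inj (suc i) (suc j) eq = cong suc (φ-inj i j eq)
  ψ′-inj : ∀ p q → proj₁ (ψ′ p) ≡ proj₁ (ψ′ q) → proj₁ p ≡ proj₁ q
  ψ′-inj ((zero , suc j) , _)  ((zero , suc j′) , _)   eq = cong (λ i → zero , suc i) (e-inj j j′ eq)
  ψ′-inj ((zero , suc j) , _)  ((suc _ , suc _) , _)   eq = contradiction eq (e≢ψ j _)
  ψ′-inj ((suc _ , suc _) , _) ((zero , suc j) , _)    eq = contradiction (sym eq) (e≢ψ j _)
  ψ′-inj ((suc i , suc j) , _) ((suc i′ , suc j′) , _) eq = cong (Product.map suc suc) (ψ-inj _ _ eq)
  ⊆ψ′ : ∀ p → φ′ (proj₁ (proj₁ p)) ∈ₑ ψ′ p × φ′ (proj₂ (proj₁ p)) ∈ₑ ψ′ p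
  ⊆ψ′ ((zero , suc j) , _)  = ∈e j
  ⊆ψ′ ((suc _ , suc _) , _) = ⊆ψ _
  colψ′ : ∀ p → col (ψ′ p) ≡ κ
  colψ′ ((zero , suc j) , _)  = cole j
  colψ′ ((suc _ , suc _) , _) = colψ _

-- Explicit descriptions of Berge copies

infixr 5 _⟪_⟫_

-- x ⟪ zs ⟫ p adds the core vertex x to p; the pair formed by x and the i-th core vertex of p
-- is covered by the triple whose third vertex is the i-th entry of zs.
data Plan (m : ℕ) : ℕ → Set where
  ∅     : Plan m 0
  _⟪_⟫_ : Fin m → Vec (Fin m) k → Plan m k → Plan m (suc k)

core : Plan m k → Vec (Fin m) k
core ∅           = []
core (x ⟪ _ ⟫ p) = x ∷ core p

row : Fin m → Vec (Fin m) k → Plan m k → Fin k → Tri (Fin m)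
row x zs p i = x , lookup (core p) i , lookup zs i

edges : Plan m k → List (Tri (Fin m))
edges ∅            = []
edges (x ⟪ zs ⟫ p) = List.tabulate (row x zs p) ++ edges p

-- Under `Valid` all triples are distinct, so `⊑` between two of them is equality as sets; thus no
-- hyperedge serves two pairs.
Separate : Plan m k → Set
Separate ∅ = ⊤
Separate (x ⟪ zs ⟫ p) =
  (∀ i → lookup (core p) i ≢ x) ×
  (∀ i j → row x zs p i ⊑ row x zs p j → i ≡ j) ×
  (∀ i → All (λ u → ¬ row x zs p i ⊑ u) (edges p)) ×
  Separate p

Valid : Plan m k → Set
Valid p = All Distinct (edges p) × Separate p

_∈₃?_ : ∀ (x : Fin m) t → Dec (x ∈₃ t)
x ∈₃? (a , b , c) = x ≟ a ⊎-dec x ≟ b ⊎-dec x ≟ c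

_⊑?_ : ∀ (t u : Tri (Fin m)) → Dec (t ⊑ u)
(a , b , c) ⊑? u = a ∈₃? u ×-dec b ∈₃? u ×-dec c ∈₃? u

distinct? : ∀ (t : Tri (Fin m)) → Dec (Distinct t)
distinct? (a , b , c) = ¬? (a ≟ b) ×-dec ¬? (a ≟ c) ×-dec ¬? (b ≟ c)

separate? : ∀ (p : Plan m k) → Dec (Separate p)
separate? ∅ = yes tt
separate? (x ⟪ zs ⟫ p) =
  all? (λ i → ¬? (lookup (core p) i ≟ x)) ×-dec
  all? (λ i → all? (λ j → (row x zs p i ⊑? row x zs p j) →-dec (i ≟ j))) ×-dec
  all? (λ i → All.all? (λ u → ¬? (row x zs p i ⊑? u)) (edges p)) ×-dec
  separate? p

valid? : ∀ (p : Plan m k) → Dec (Valid p)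
valid? p = All.all? distinct? (edges p) ×-dec separate? p

inj-∈₃ : ∀ {f : Fin m → Fin N} → Inj f → ∀ {x t} → f x ∈₃ map₃ f t → x ∈₃ t
inj-∈₃ f-inj = Sum.map (f-inj _ _) (Sum.map (f-inj _ _) (f-inj _ _))

inj-⊑ : ∀ {f : Fin m → Fin N} → Inj f → ∀ {t u} → map₃ f t ⊑ map₃ f u → t ⊑ u
inj-⊑ f-inj {t} {u} (p , q , r) = inj-∈₃ f-inj {t = u} p , inj-∈₃ f-inj {t = u} q , inj-∈₃ f-inj {t = u} r

inj-distinct : ∀ {f : Fin m → Fin N} → Inj f → ∀ {t} → Distinct t → Distinct (map₃ f t)
inj-distinct f-inj (p , q , r) = (p ∘ f-inj _ _) , (q ∘ f-inj _ _) , (r ∘ f-inj _ _)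

-- The image of `u` exhausts `e′`, because `u` is distinct; injectivity of `f` then pulls the
-- containment back to the plan.
clash : ∀ {f : Fin m → Fin N} → Inj f → ∀ {t u} {e e′ : Triple N} → Distinct u →
  map₃ f t ⊑ proj₁ e → map₃ f u ⊑ proj₁ e′ → proj₁ e ≡ proj₁ e′ → t ⊑ u
clash f-inj {t} {u} d t⊑e u⊑e′ refl =
  inj-⊑ f-inj {t} {u} (⊑-trans t⊑e (distinct-⊑-sym (inj-distinct f-inj d) u⊑e′))

-- Besides the copy, the origin of its core and of each hyperedge is recorded. The induction needs
-- this to separate the new hyperedges from the old ones.
Realisation : (col : Colouring N) → Bool → (Fin m → Fin N) → Plan m k → Set
Realisation {N} {k = k} col κ f p = Σ (MonoBergeK N col κ k) λ K →
  (∀ i → proj₁ K i ≡ f (lookup (core p) i)) ×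
  (∀ q → Any (λ t → Distinct t × map₃ f t ⊑ proj₁ (proj₁ (proj₂ K) q)) (edges p))

realise : ∀ {col : Colouring N} {f : Fin m → Fin N} → Inj f → (p : Plan m k) → Valid p →
  All (λ t → Hued col κ (map₃ f t)) (edges p) → Realisation col κ f p
realise {col = col} f-inj ∅ _ _ = noVertices {col = col} , (λ ()) , λ ()
realise {N} {k = suc k} {κ} {col = col} {f} f-inj (x ⟪ zs ⟫ p) (dist , x∉p , row-inj , row≢p , sep) hued
  with K , φ≡ , ψ⊒ ← realise {col = col} f-inj p (All.++⁻ʳ (List.tabulate (row x zs p)) dist , sep)
                       (All.++⁻ʳ (List.tabulate (row x zs p)) hued)
  = addVertex {col = col} K (f x) e
      (λ i eq → x∉p i (f-inj _ _ (trans (sym (φ≡ i)) eq)))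
      (λ i j eq → row-inj i j (clash f-inj {e = e i} {e j} (rowDist j) (⊑e i) (⊑e j) eq))
      (λ i q eq → disjoint i (e i) (proj₁ (proj₂ K) q) (⊑e i) eq (ψ⊒ q))
      (λ i → proj₁ (⊑e i) , subst (_∈₃ _) (sym (φ≡ i)) (proj₁ (proj₂ (⊑e i))))
      (λ i → proj₂ (proj₂ (rowHued i)))
    , (λ { zero → refl ; (suc i) → φ≡ i })
    , λ { ((zero , suc j) , _) → Any.++⁺ˡ (Any.tabulate⁺ j (rowDist j , ⊑e j))
        ; ((suc i , suc j) , i<j) → Any.++⁺ʳ (List.tabulate (row x zs p)) (ψ⊒ ((i , j) , s<s⁻¹ i<j)) }
  where
  rowHued : ∀ i → Hued col κ (map₃ f (row x zs p i))
  rowHued = All.tabulate⁻ (All.++⁻ˡ (List.tabulate (row x zs p)) hued)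
  rowDist : ∀ i → Distinct (row x zs p i)
  rowDist = All.tabulate⁻ (All.++⁻ˡ (List.tabulate (row x zs p)) dist)
  e : Fin k → Triple N
  e i = proj₁ (rowHued i)
  ⊑e : ∀ i → map₃ f (row x zs p i) ⊑ proj₁ (e i)
  ⊑e i = proj₁ (proj₂ (rowHued i))
  disjoint : ∀ i (e e′ : Triple N) → map₃ f (row x zs p i) ⊑ proj₁ e → proj₁ e ≡ proj₁ e′ →
    ¬ Any (λ t → Distinct t × map₃ f t ⊑ proj₁ e′) (edges p)
  disjoint i e e′ ⊑e eq any with u≢ , d , u⊑e′ ← All.lookupAny (row≢p i) any =
    u≢ (clash f-inj {e = e} {e′} d ⊑e u⊑e′ eq)

berge : ∀ {col : Colouring N} {f : Fin m → Fin N} → Inj f → (p : Plan m k) → {True (valid? p)} →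
  All (λ t → Hued col κ (map₃ f t)) (edges p) → MonoBergeK N col κ k
berge {col = col} f-inj p {ok} hued = proj₁ (realise {col = col} f-inj p (toWitness ok) hued)

-- Case analysis by red patterns

Pattern : ℕ → Set
Pattern m = List (Tri (Fin m))

data Reply (m s : ℕ) : Set where
  copy    : Plan m s → Reply m s
  below : ℕ → Vec (Fin m) m → Reply m s

-- Suppose that the triples of `given` are red. If those used by `target` are all blue, they form a blue K_t.
-- Otherwise one of them is red; its reply then points out a red K_s, or (`below i π`) an occurrence, under the
-- relabelling π, of the pattern of the case that comes i + 1 places further down the list.
record Case (m s t : ℕ) : Set where
  constructor case
  field
    given   : Pattern m
    target  : Plan m t
    replies : List (Reply m s)
open Case

-- `H` holds the triples known to be red, and `Γ` the patterns of later cases only, so references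
-- between cases cannot be circular.
Settles : List (Pattern m) → Pattern m → Reply m s → Set
Settles _ H (copy p) = Valid p × All (λ u → Any (u ⊑_) H) (edges p)
Settles [] H (below _ _) = ⊥
Settles (H₀ ∷ _) H (below zero π) = Inj (lookup π) × All (λ u → Any (map₃ (lookup π) u ⊑_) H) H₀
Settles {s = s} (_ ∷ Γ) H (below (suc i) π) = Settles {s = s} Γ H (below i π)

Checked : List (Case m s t) → Set
Checked []       = ⊤
Checked (c ∷ cs) =
  (Valid (target c) × Pointwise (λ q → Settles (List.map given cs) (q ∷ given c)) (edges (target c)) (replies c)) ×
  Checked cs

settles? : ∀ (Γ : List (Pattern m)) H (r : Reply m s) → Dec (Settles Γ H r)
settles? Γ H (copy p) = valid? p ×-dec All.all? (λ u → Any.any? (u ⊑?_) H) (edges p)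
settles? [] H (below _ _) = no λ ()
settles? (H₀ ∷ _) H (below zero π) =
  all? (λ i → all? (λ j → (lookup π i ≟ lookup π j) →-dec (i ≟ j))) ×-dec
  All.all? (λ u → Any.any? (map₃ (lookup π) u ⊑?_) H) H₀
settles? (_ ∷ Γ) H (below (suc i) π) = settles? Γ H (below i π)

checked? : ∀ (cs : List (Case m s t)) → Dec (Checked cs)
checked? []       = yes tt
checked? (c ∷ cs) =
  (valid? (target c) ×-dec
    Pointwise.decidable (λ q → settles? (List.map given cs) (q ∷ given c)) (edges (target c)) (replies c)) ×-dec
  checked? cs

module _ {N m s t : ℕ} (col : Colouring N) where

  Outcome : Set
  Outcome = MonoBergeK N col true s ⊎ MonoBergeK N col false t

  Reds Blues : (Fin m → Fin N) → Pattern m → Set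
  Reds  f = All (λ t → Hued col true (map₃ f t))
  Blues f = All (λ t → Hued col false (map₃ f t))

  Forcing : Pattern m → Set
  Forcing H = ∀ f → Inj f → Reds f H → Outcome

  reds-⊆ : ∀ {H f} (π : Fin m → Fin m) {H₀} → Reds f H →
    All (λ u → Any (map₃ π u ⊑_) H) H₀ → Reds (f ∘ π) H₀
  reds-⊆ {f = f} π reds = All.map pick
    where
    pick : ∀ {u} → Any (map₃ π u ⊑_) _ → Hued col true (map₃ (f ∘ π) u)
    pick {u} any with red , ⊑t ← All.lookupAny reds any = hued-⊑ {col = col} (⊑-map f {map₃ π u} ⊑t) red

  settle : ∀ {Γ H f} → All Forcing Γ → Inj f → Reds f H → (r : Reply m s) → Settles Γ H r → Outcome
  settle _ f-inj reds (copy p) (ok , p⊆H) = inj₁ (proj₁ (realise {col = col} f-inj p ok (reds-⊆ id reds p⊆H)))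
  settle {f = f} (force ∷ _) f-inj reds (below zero π) (π-inj , H₀⊆H) =
    force (f ∘ lookup π) (λ i j → π-inj i j ∘ f-inj _ _) (reds-⊆ (lookup π) reds H₀⊆H)
  settle (_ ∷ forces) f-inj reds (below (suc i) π) ok = settle forces f-inj reds (below i π) ok

  -- The target triples are examined in turn. The first red one is added to `H`, and its reply
  -- settles the case.
  blues-or : ∀ {Γ H f} → All Forcing Γ → Inj f → Reds f H → ∀ {qs} {rs : List (Reply m s)} →
    All Distinct qs → Pointwise (λ q → Settles Γ (q ∷ H)) qs rs → Blues f qs ⊎ Outcome
  blues-or forces f-inj reds [] [] = inj₁ []
  blues-or forces f-inj reds {rs = r ∷ _} (d ∷ ds) (ok ∷ oks) with hued-either col (inj-distinct f-inj d)
  ... | inj₁ red  = inj₂ (settle forces f-inj (red ∷ reds) r ok)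
  ... | inj₂ blue = Sum.map₁ (blue ∷_) (blues-or forces f-inj reds ds oks)

  forcing : (cs : List (Case m s t)) → Checked cs → All Forcing (List.map given cs)
  forcing [] _ = []
  forcing (c ∷ cs) ((ok@(dist , _) , replies) , oks) = force ∷ forcing cs oks
    where
    force : Forcing (given c)
    force f f-inj reds with blues-or (forcing cs oks) f-inj reds dist replies
    ... | inj₁ blues   = inj₂ (proj₁ (realise {col = col} f-inj (target c) ok blues))
    ... | inj₂ outcome = outcome

-- The first case assumes no red triple, so it applies to every colouring, with the identity as
-- placement.
arrows-by-cases : ∀ (cs : List (Case N s t)) → {True (checked? cs)} →
  List.head (List.map given cs) ≡ just [] → Arrows N s t
arrows-by-cases cs {ok} start col with List.map given cs | forcing col cs (toWitness ok)
arrows-by-cases cs {ok} refl col | [] ∷ _ | force ∷ _ = force id (λ _ _ → id) []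

-- Bounds on three to six vertices

-- Vertices are written as the decimal digits 1, …, m + 1 (the last one being `zero`), read from right to left.
vertices : ∀ k → ℕ → Vec (Fin (suc m)) k × ℕ
vertices zero    n = [] , n
vertices {m} (suc k) n = Product.map₁ ((n % 10) mod suc m ∷_) (vertices k (n / 10))

triple : ℕ → Tri (Fin (suc m))
triple n with a ∷ b ∷ c ∷ [] , _ ← vertices 3 n = a , b , c

-- From the right, the digits give the core vertex of the outermost row, then its third vertices,
-- then the next row in the same way.
plan : ∀ {k} → ℕ → Plan (suc m) k
plan {k = zero}  n = ∅
plan {k = suc k} n with xs , rest ← vertices (suc k) n = Vec.head xs ⟪ Vec.tail xs ⟫ plan rest

copy# : ℕ → Reply (suc m) s
copy# n = copy (plan n)

-- The rightmost digit is the image of `zero`; on five vertices 43215 is the identity.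
below# : ℕ → ℕ → Reply (suc m) s
below# i n = below i (proj₁ (vertices _ n))

case# : List ℕ → ℕ → List (Reply (suc m) s) → Case (suc m) s t
case# ts n = case (List.map triple ts) (plan n)

-- One red triple may be assumed. Either the six triples sharing two vertices with it form a blue
-- Berge K₄, or two red triples have two common vertices. Then every triple of the last target
-- completes a red Berge K₃.
arrows-5-3-4 : Arrows 5 3 4
arrows-5-3-4 = arrows-by-cases cases refl
  where
  cases : List (Case 5 3 4)
  cases =
    case# [] 4535521115
      (below# 0 43215 ∷ below# 0 42315 ∷ below# 0 32415 ∷ below# 0 41325 ∷ below# 0 31425 ∷
       below# 0 21435 ∷ []) ∷
    case# (215 ∷ []) 3522411445
      (below# 0 34215 ∷ below# 0 34125 ∷ below# 0 43215 ∷ below# 0 34521 ∷ below# 0 43521 ∷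
       below# 0 43125 ∷ []) ∷
    case# (215 ∷ 315 ∷ []) 4535522431
      (copy# 231135 ∷ copy# 341125 ∷ copy# 241135 ∷ copy# 251335 ∷ copy# 251435 ∷ copy# 351425 ∷ []) ∷
    []

-- A Berge K₄ has six hyperedges, so red copies arise only from patterns of five red triples and a
-- further one. Every other reply exhibits a later pattern.
arrows-6-4-5 : Arrows 6 4 5
arrows-6-4-5 = arrows-by-cases cases refl
  where
  cases : List (Case 6 4 5)
  cases =
    case# [] 564663666266661
      (below# 0 543216 ∷ below# 0 542316 ∷ below# 0 532416 ∷ below# 0 432516 ∷
       below# 0 541326 ∷ below# 0 531426 ∷ below# 0 431526 ∷ below# 0 521436 ∷
       below# 0 421536 ∷ below# 0 321546 ∷ []) ∷
    case# (216 ∷ []) 564663662122236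
      (below# 0 543216 ∷ below# 0 543126 ∷ below# 0 534126 ∷ below# 0 435126 ∷
       below# 0 543621 ∷ below# 0 534216 ∷ below# 0 435216 ∷ below# 1 524316 ∷
       below# 1 425316 ∷ below# 1 325416 ∷ []) ∷
    case# (216 ∷ 316 ∷ []) 564113114223546
      (below# 0 534216 ∷ below# 0 425316 ∷ below# 0 524316 ∷ below# 0 435216 ∷
       below# 0 514362 ∷ below# 0 534261 ∷ below# 0 435261 ∷ below# 0 524361 ∷
       below# 0 425361 ∷ below# 0 325416 ∷ []) ∷
    case# (416 ∷ 326 ∷ []) 524113111215556
      (below# 1 534126 ∷ below# 1 524136 ∷ below# 1 513246 ∷ below# 1 543216 ∷
       below# 3 543216 ∷ below# 3 534126 ∷ below# 0 435216 ∷ below# 3 524136 ∷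
       below# 0 425316 ∷ below# 0 315426 ∷ []) ∷
    case# (516 ∷ 426 ∷ 321 ∷ []) 514652264133336
      (below# 0 534216 ∷ below# 0 435126 ∷ below# 0 325146 ∷ below# 0 314256 ∷
       below# 0 435621 ∷ below# 0 543261 ∷ below# 0 534612 ∷ below# 0 563142 ∷
       below# 0 543162 ∷ below# 0 463251 ∷ []) ∷
    case# (416 ∷ 516 ∷ 326 ∷ []) 524113111223546
      (below# 0 534216 ∷ below# 0 425316 ∷ below# 0 524316 ∷ below# 0 435216 ∷
       below# 1 543216 ∷ below# 1 534126 ∷ below# 1 435126 ∷ below# 1 524136 ∷
       below# 1 425136 ∷ below# 1 321654 ∷ []) ∷
    case# (316 ∷ 516 ∷ 326 ∷ 426 ∷ []) 514153354222431
      (below# 0 453216 ∷ below# 0 523146 ∷ below# 0 534216 ∷ below# 0 435126 ∷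
       below# 0 514236 ∷ below# 0 314256 ∷ below# 0 413256 ∷ below# 0 152643 ∷
       below# 0 425136 ∷ below# 0 325146 ∷ []) ∷
    case# (416 ∷ 326 ∷ 321 ∷ []) 463142365125526
      (below# 0 543216 ∷ below# 1 543126 ∷ below# 1 542136 ∷ below# 7 543126 ∷
       below# 1 543621 ∷ below# 0 542316 ∷ below# 7 542631 ∷ below# 5 534162 ∷
       below# 7 543621 ∷ below# 7 542136 ∷ []) ∷
    case# (216 ∷ 416 ∷ 326 ∷ 321 ∷ []) 524113114223546
      (below# 6 543126 ∷ below# 0 452316 ∷ below# 6 542316 ∷ below# 0 543126 ∷
       below# 4 534162 ∷ below# 6 543621 ∷ below# 0 543621 ∷ below# 6 524316 ∷
       below# 0 452361 ∷ below# 0 351462 ∷ []) ∷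
    case# (316 ∷ 516 ∷ 426 ∷ 321 ∷ []) 423552544135546
      (below# 5 543216 ∷ below# 5 453216 ∷ below# 1 453126 ∷ below# 5 541236 ∷
       below# 5 534621 ∷ below# 3 534261 ∷ below# 2 354261 ∷ below# 5 462531 ∷
       below# 0 435162 ∷ below# 5 541632 ∷ []) ∷
    case# (516 ∷ 426 ∷ 536 ∷ 321 ∷ 421 ∷ []) 513662465144146
      (below# 1 453216 ∷ below# 4 452316 ∷ copy# 4632212556 ∷ below# 4 352146 ∷ below# 4 354621 ∷
       copy# 3126415456 ∷ below# 4 352641 ∷ copy# 3622415456 ∷ below# 2 453216 ∷ copy# 3125415456 ∷
       []) ∷
    case# (516 ∷ 326 ∷ 426 ∷ 436 ∷ 321 ∷ []) 514613615226661
      (copy# 3622614456 ∷ copy# 3626314456 ∷ copy# 4626313356 ∷ copy# 3622514456 ∷ below# 1 435162 ∷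
       copy# 3622414456 ∷ below# 0 543126 ∷ copy# 3624314456 ∷ below# 0 542136 ∷ copy# 4625313356 ∷
       []) ∷
    case# (416 ∷ 516 ∷ 526 ∷ 436 ∷ 321 ∷ []) 524123316232116
      (below# 2 542316 ∷ below# 2 453216 ∷ copy# 4626313556 ∷ copy# 5636212446 ∷ below# 2 453126 ∷
       copy# 4126313556 ∷ copy# 5236212446 ∷ copy# 4326313556 ∷ copy# 5136212446 ∷ copy# 4526313556 ∷
       []) ∷
    case# (416 ∷ 426 ∷ 436 ∷ 321 ∷ []) 514613636262661
      (below# 1 542316 ∷ below# 1 543216 ∷ below# 1 526341 ∷ below# 0 543216 ∷
       below# 1 543126 ∷ below# 1 536142 ∷ below# 0 543126 ∷ below# 1 536241 ∷
       below# 0 542136 ∷ below# 0 563214 ∷ []) ∷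
    case# (416 ∷ 516 ∷ 426 ∷ 436 ∷ 321 ∷ []) 524613636222661
      (copy# 4626313156 ∷ copy# 4636212156 ∷ copy# 4126313456 ∷ below# 0 345216 ∷ copy# 4626313356 ∷
       copy# 4326313456 ∷ copy# 4626313556 ∷ copy# 4136212456 ∷ copy# 4636212556 ∷ copy# 4526313456 ∷
       []) ∷
    case# (316 ∷ 416 ∷ 426 ∷ 321 ∷ []) 514113415235436
      (below# 0 543216 ∷ below# 3 542316 ∷ below# 1 543216 ∷ below# 2 542136 ∷
       below# 4 543162 ∷ below# 0 534261 ∷ below# 4 534612 ∷ below# 3 532461 ∷
       below# 1 534261 ∷ below# 2 532641 ∷ []) ∷
    case# (316 ∷ 416 ∷ 326 ∷ 426 ∷ 321 ∷ []) 564663114235461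
      (copy# 3126612446 ∷ copy# 3624311446 ∷ copy# 4625311336 ∷ copy# 3625311446 ∷ copy# 3426312446 ∷
       copy# 3622411446 ∷ copy# 3622511446 ∷ copy# 3626314446 ∷ copy# 3626315446 ∷ copy# 4626315336 ∷
       []) ∷
    case# (316 ∷ 416 ∷ 426 ∷ 546 ∷ 321 ∷ []) 524623424123226
      (copy# 4626315136 ∷ copy# 4626315336 ∷ below# 1 542316 ∷ copy# 4626315536 ∷ below# 1 532461 ∷
       copy# 4126315436 ∷ below# 0 532641 ∷ copy# 4326315436 ∷ below# 0 542136 ∷ copy# 4526315436 ∷
       []) ∷
    case# (216 ∷ 516 ∷ 426 ∷ 436 ∷ 321 ∷ []) 514413336236641
      (copy# 4622313156 ∷ copy# 3126614456 ∷ copy# 4626313156 ∷ copy# 3125614456 ∷ copy# 3622614456 ∷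
       copy# 3422614456 ∷ copy# 3522614456 ∷ copy# 3124614456 ∷ below# 1 514623 ∷ copy# 4625313156 ∷
       []) ∷
    case# (216 ∷ 416 ∷ 426 ∷ 436 ∷ 321 ∷ []) 513642444115336
      (copy# 3126614446 ∷ copy# 3622614446 ∷ copy# 4636212526 ∷ copy# 4626313156 ∷ copy# 4126313426 ∷
       copy# 3124614446 ∷ copy# 4625313146 ∷ copy# 3422614446 ∷ copy# 4626313526 ∷ copy# 3125614446 ∷
       []) ∷
    case# (416 ∷ 326 ∷ 536 ∷ 321 ∷ 421 ∷ []) 453352356124536
      (copy# 3126415346 ∷ copy# 3622415546 ∷ copy# 4631121536 ∷ copy# 3622415446 ∷ copy# 3622415146 ∷
       copy# 3125415346 ∷ copy# 3124415346 ∷ copy# 3522415346 ∷ copy# 3422415346 ∷ copy# 4531121536 ∷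
       []) ∷
    []

arrows-3-2-2 : Arrows 3 2 2
arrows-3-2-2 = arrows-by-cases (case# [] 213 (copy# 213 ∷ []) ∷ []) refl

arrows-4-2-3 : Arrows 4 2 3
arrows-4-2-3 = arrows-by-cases (case# [] 341224 (copy# 124 ∷ copy# 234 ∷ copy# 134 ∷ []) ∷ []) refl

-- The target uses each of the ten triples once, for the ten pairs; a single red triple is already a
-- red Berge K₂.
arrows-5-2-5 : Arrows 5 2 5
arrows-5-2-5 = arrows-by-cases (case# [] 453542243111325
  (copy# 125 ∷ copy# 235 ∷ copy# 135 ∷ copy# 145 ∷ copy# 231 ∷
   copy# 341 ∷ copy# 241 ∷ copy# 342 ∷ copy# 245 ∷ copy# 345 ∷ []) ∷ []) refl

-- Deletion of a vertex, monotonicity and colour symmetry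

lift : Fin (suc N) → Triple N → Triple (suc N)
lift v ((a , b , c) , a<b , b<c) = map₃ (punchIn v) (a , b , c) , mono a<b , mono b<c
  where
  mono : ∀ {i j} → i <ᶠ j → punchIn v i <ᶠ punchIn v j
  mono {i} {j} i<j = Fin.≤∧≢⇒< (Fin.punchIn-mono-≤ v i j (ℕ.<⇒≤ i<j))
    (Fin.<⇒≢ i<j ∘ Fin.punchIn-injective v i j)

delete : Fin (suc N) → Colouring (suc N) → Colouring N
delete v col = col ∘ lift v

lift-avoids : ∀ (v : Fin (suc N)) e → ¬ v ∈ₑ lift v e
lift-avoids v e (inj₁ eq)        = Fin.punchInᵢ≢i v _ (sym eq)
lift-avoids v e (inj₂ (inj₁ eq)) = Fin.punchInᵢ≢i v _ (sym eq)
lift-avoids v e (inj₂ (inj₂ eq)) = Fin.punchInᵢ≢i v _ (sym eq)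

undelete : ∀ (col : Colouring (suc N)) v → MonoBergeK N (delete v col) κ k → MonoBergeK (suc N) col κ k
undelete col v (φ , ψ , φ-inj , ψ-inj , ⊆ψ , colψ) =
  punchIn v ∘ φ , lift v ∘ ψ ,
  (λ i j eq → φ-inj i j (Fin.punchIn-injective v _ _ eq)) ,
  (λ p q eq → ψ-inj p q (map₃-injective eq)) ,
  (λ p → Product.map (∈₃-map (punchIn v) {t = proj₁ (ψ p)}) (∈₃-map (punchIn v) {t = proj₁ (ψ p)}) (⊆ψ p)) ,
  colψ
  where
  map₃-injective : ∀ {t u} → map₃ (punchIn v) t ≡ map₃ (punchIn v) u → t ≡ u
  map₃-injective eq = cong₂ _,_ (Fin.punchIn-injective v _ _ (cong proj₁ eq))
    (cong₂ _,_ (Fin.punchIn-injective v _ _ (cong (proj₁ ∘ proj₂) eq))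
               (Fin.punchIn-injective v _ _ (cong (proj₂ ∘ proj₂) eq)))

arrows-suc : Arrows N s t → Arrows (suc N) s t
arrows-suc arr col = Sum.map (undelete col zero) (undelete col zero) (arr (delete zero col))

arrows-≤ : ∀ {M} → M ≤ N → Arrows M s t → Arrows N s t
arrows-≤ M≤N = go (ℕ.≤⇒≤′ M≤N)
  where
  go : ∀ {M N} → M ≤′ N → Arrows M s t → Arrows N s t
  go ≤′-refl       arr = arr
  go (≤′-step M≤N) arr = arrows-suc (go M≤N arr)

up : Pair k → Pair (suc k)
up ((i , j) , i<j) = (suc i , suc j) , s<s i<j

dropVertex : ∀ {col : Colouring N} → MonoBergeK N col κ (suc k) → MonoBergeK N col κ k
dropVertex (φ , ψ , φ-inj , ψ-inj , ⊆ψ , colψ) =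
  φ ∘ suc , ψ ∘ up ,
  (λ i j eq → Fin.suc-injective (φ-inj _ _ eq)) ,
  (λ p q eq → cong₂ _,_ (Fin.suc-injective (cong proj₁ (ψ-inj _ _ eq)))
                        (Fin.suc-injective (cong proj₂ (ψ-inj _ _ eq)))) ,
  ⊆ψ ∘ up , colψ ∘ up

flip : Colouring N → Colouring N
flip col = not ∘ col

unflip : ∀ (col : Colouring N) → MonoBergeK N (flip col) κ k → MonoBergeK N col (not κ) k
unflip col (φ , ψ , φ-inj , ψ-inj , ⊆ψ , colψ) =
  φ , ψ , φ-inj , ψ-inj , ⊆ψ , λ p → trans (sym (Bool.not-involutive (col (ψ p)))) (cong not (colψ p))

arrows-sym : Arrows N s t → Arrows N t s
arrows-sym arr col = Sum.swap (Sum.map (unflip col) (unflip col) (arr (flip col)))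

-- Were every vertex hit, choosing preimages would inject `Fin n` into `Fin k`.
missed : ∀ {n} → k < n → (φ : Fin k → Fin n) → ∃[ b ] (∀ i → φ i ≢ b)
missed k<n φ with any? (λ b → ¬? (any? λ i → φ i ≟ b))
... | yes (b , b∉φ) = b , λ i eq → b∉φ (i , eq)
... | no all = contradiction (pigeonhole k<n (proj₁ ∘ preimage)) collision
  where
  preimage : ∀ b → ∃[ i ] φ i ≡ b
  preimage b = decidable-stable (any? λ i → φ i ≟ b) λ none → all (b , none)
  collision : ¬ ∃ λ b → ∃ λ b′ → b <ᶠ b′ × proj₁ (preimage b) ≡ proj₁ (preimage b′)
  collision (b , b′ , b<b′ , eq) =
    Fin.<⇒≢ b<b′ (trans (sym (proj₂ (preimage b))) (trans (cong φ eq) (proj₂ (preimage b′))))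

hued-or : ∀ (col : Colouring N) κ {t} → Distinct t → Hued col κ t ⊎ Hued col (not κ) t
hued-or col true  d = hued-either col d
hued-or col false d = Sum.swap (hued-either col d)

hued-not : ∀ (col : Colouring N) {κ t} → Distinct t → Hued col κ t → ¬ Hued col (not κ) t
hued-not col {true}  d h h′ = hued-exclusive col d h h′
hued-not col {false} d h h′ = hued-exclusive col d h′ h

hued? : ∀ (col : Colouring N) κ {t} → Distinct t → Dec (Hued col κ t)
hued? col κ d with hued-or col κ d
... | inj₁ h = yes h
... | inj₂ h = no λ h′ → hued-not col d h′ h

swap₃ : ∀ {col : Colouring N} {a b c} → Hued col κ (a , b , c) → Hued col κ (a , c , b)
swap₃ {col = col} = hued-⊑ {col = col} (inj₁ refl , inj₂ (inj₂ refl) , inj₂ (inj₁ refl))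

rotate₃ : ∀ {col : Colouring N} {a b c} → Hued col κ (a , b , c) → Hued col κ (b , c , a)
rotate₃ {col = col} = hued-⊑ {col = col} (inj₂ (inj₁ refl) , inj₂ (inj₂ refl) , inj₁ refl)

-- Orientations of the link graph and cuts

module _ {L : Fin N → Fin N → Set} (L? : ∀ x y → Dec (L x y)) where

  -- Without 2-cycles the pairs of `x` and `h x`, for `x` in `D`, are pairwise different: `h`
  -- chooses a separate edge for every vertex of `D`.
  OrientsAt : Subset N → Set
  OrientsAt D = Σ (Fin N → Fin N) λ h →
    (∀ {x} → x ∈ D → L x (h x)) × (∀ {x y} → x ∈ D → y ∈ D → h x ≡ y → h y ≢ x)

  -- No edge leaves `C`, not even towards the outside of `D`; hence a set found for a smaller `D`
  -- also serves a larger one.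
  ClosedIn : Subset N → Set
  ClosedIn D = Σ (Subset N) λ C → Nonempty C × C ⊆ D × (∀ {x y} → x ∈ C → y ∉ C → ¬ L x y)

  -- Peel off a vertex x ∈ D with a neighbour y ∉ D; as x is oriented out of D, no 2-cycle can arise.
  orient-or-closed : ∀ D → OrientsAt D ⊎ ClosedIn D
  orient-or-closed D = go D (⊂-wellFounded D)
    where
    go : ∀ D → Acc _⊂_ D → OrientsAt D ⊎ ClosedIn D
    go D (acc rec) with any? (λ x → any? (λ y → (x Subset.∈? D) ×-dec ¬? (y Subset.∈? D) ×-dec L? x y))
    ... | no none with Subset.nonempty? D
    ...   | yes ne = inj₂ (D , ne , id , λ x∈ y∉ Lxy → none (_ , _ , x∈ , y∉ , Lxy))
    ...   | no empty = inj₁ (id , (λ x∈ → contradiction (_ , x∈) empty) , λ x∈ → contradiction (_ , x∈) empty)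
    go D (acc rec) | yes (x , y , x∈D , y∉D , Lxy) with go (D - x) (rec (Subset.x∈p⇒p-x⊂p x∈D))
    ... | inj₂ (C , ne , C⊆ , closed) = inj₂ (C , ne , (λ z∈ → Subset.p─q⊆p D _ (C⊆ z∈)) , closed)
    ... | inj₁ (h , Lh , acyclic) = inj₁ (h′ , Lh′ , acyclic′)
      where
      h′ : Fin N → Fin N
      h′ z with z ≟ x
      ... | yes _ = y
      ... | no  _ = h z
      Lh′ : ∀ {z} → z ∈ D → L z (h′ z)
      Lh′ {z} z∈D with z ≟ x
      ... | yes refl = Lxy
      ... | no  z≢x  = Lh (Subset.x∈p∧x≢y⇒x∈p-y z∈D z≢x)
      acyclic′ : ∀ {z w} → z ∈ D → w ∈ D → h′ z ≡ w → h′ w ≢ z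
      acyclic′ {z} {w} z∈D w∈D eq eq′ with z ≟ x | w ≟ x
      ... | yes _ | _ = contradiction (subst (_∈ D) (sym eq) w∈D) y∉D
      ... | no _ | yes _ = contradiction (subst (_∈ D) (sym eq′) z∈D) y∉D
      ... | no z≢x | no w≢x =
        acyclic (Subset.x∈p∧x≢y⇒x∈p-y z∈D z≢x) (Subset.x∈p∧x≢y⇒x∈p-y w∈D w≢x) eq eq′

-- The link of `v` contains, in colour `κ`, a spanning complete bipartite graph on the other
-- vertices. `side` takes an arbitrary value at `v`; applying `opposite` twice reaches a vertex of
-- each side.
record Cut (col : Colouring N) (κ : Bool) (v : Fin N) : Set where
  field
    side     : Fin N → Bool
    opposite : ∀ x → ∃[ y ] y ≢ v × side x ≢ side y
    cross    : ∀ {x y} → x ≢ v → y ≢ v → side x ≢ side y → Hued col κ (v , x , y)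

edge? : ∀ (col : Colouring N) κ t → Dec (Distinct t × Hued col κ t)
edge? col κ t with distinct? t
... | no ¬d = no (¬d ∘ proj₁)
... | yes d with hued? col κ d
...   | yes h = yes (d , h)
...   | no ¬h = no (¬h ∘ proj₂)

-- All triples at v are unused by a copy avoiding v; they serve for the new pairs v, φ i as soon as
-- the pairs φ i, h i are distinct, i.e. as h has no 2-cycle.
attach : ∀ (col : Colouring (suc N)) v (K : MonoBergeK N (delete v col) κ k) (h : Fin k → Fin (suc N)) →
  (∀ i → Distinct (v , punchIn v (proj₁ K i) , h i) × Hued col κ (v , punchIn v (proj₁ K i) , h i)) →
  (∀ i j → h i ≡ punchIn v (proj₁ K j) → h j ≢ punchIn v (proj₁ K i)) →
  MonoBergeK (suc N) col κ (suc k)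
attach {N} {κ} {k} col v K h edge acyclic =
  addVertex {col = col} (undelete col v K) v e (λ i → Fin.punchInᵢ≢i v _) e-inj
    (λ i p eq → lift-avoids v (proj₁ (proj₂ K) p) (subst (v ∈₃_) eq (proj₁ (⊑e i))))
    (λ i → proj₁ (⊑e i) , proj₁ (proj₂ (⊑e i)))
    (λ i → proj₂ (proj₂ (proj₂ (edge i))))
  where
  φ : Fin k → Fin (suc N)
  φ i = punchIn v (proj₁ K i)
  φ-inj : Inj φ
  φ-inj i j eq = proj₁ (proj₂ (proj₂ K)) i j (Fin.punchIn-injective v _ _ eq)
  e : Fin k → Triple (suc N)
  e i = proj₁ (proj₂ (edge i))
  ⊑e : ∀ i → (v , φ i , h i) ⊑ proj₁ (e i)
  ⊑e i = proj₁ (proj₂ (proj₂ (edge i)))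
  shared : ∀ i j → proj₁ (e i) ≡ proj₁ (e j) → φ i ≡ φ j ⊎ h j ≡ φ i
  shared i j eq with distinct-covers (proj₁ (edge j)) (⊑e j) (subst (φ i ∈₃_) eq (proj₁ (proj₂ (⊑e i))))
  ... | inj₁ φi≡v         = contradiction φi≡v (Fin.punchInᵢ≢i v _)
  ... | inj₂ (inj₁ φi≡φj) = inj₁ φi≡φj
  ... | inj₂ (inj₂ φi≡hj) = inj₂ (sym φi≡hj)
  e-inj : ∀ i j → proj₁ (e i) ≡ proj₁ (e j) → i ≡ j
  e-inj i j eq with shared i j eq | shared j i (sym eq)
  ... | inj₁ same  | _          = φ-inj i j same
  ... | _          | inj₁ same  = φ-inj i j (sym same)
  ... | inj₂ hj≡φi | inj₂ hi≡φj = contradiction hj≡φi (acyclic i j hi≡φj)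

-- The link edges of colour `κ` are oriented out of the core, or a closed set `C` in the core is one
-- side of the cut. By `k < N` some vertex other than `v` lies outside the core, so the other side
-- is nonempty.
extend-or-cut : ∀ (col : Colouring (suc N)) v → k < N → MonoBergeK N (delete v col) κ k →
  MonoBergeK (suc N) col κ (suc k) ⊎ Cut col (not κ) v
extend-or-cut {N} {k} {κ} col v k<N K = Sum.map extend cut (orient-or-closed L? image)
  where
  φ : Fin k → Fin (suc N)
  φ i = punchIn v (proj₁ K i)

  L? : ∀ x y → Dec (Distinct (v , x , y) × Hued col κ (v , x , y))
  L? x y = edge? col κ (v , x , y)

  hit? : ∀ x → Dec (∃[ i ] φ i ≡ x)
  hit? x = any? λ i → φ i ≟ x

  image : Subset (suc N)
  image = Vec.tabulate (does ∘ hit?)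

  φ∈image : ∀ i → φ i ∈ image
  φ∈image i = Vec.lookup⇒[]= (φ i) image
    (trans (Vec.lookup∘tabulate (does ∘ hit?) (φ i)) (dec-true (hit? (φ i)) (i , refl)))

  image⊆φ : ∀ {x} → x ∈ image → ∃[ i ] φ i ≡ x
  image⊆φ {x} x∈ with hit? x in eq
  ... | yes hit = hit
  ... | no _ with () ← trans (sym (Vec.[]=⇒lookup x∈)) (trans (Vec.lookup∘tabulate (does ∘ hit?) x) (cong does eq))

  extend : OrientsAt L? image → MonoBergeK (suc N) col κ (suc k)
  extend (h , Lh , acyclic) =
    attach col v K (h ∘ φ) (λ i → Lh (φ∈image i)) (λ i j → acyclic (φ∈image i) (φ∈image j))

  cut : ClosedIn L? image → Cut col (not κ) v
  cut (C , (a , a∈C) , C⊆image , closed) = record { side = side ; opposite = opposite ; cross = cross }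
    where
    side : Fin (suc N) → Bool
    side x = does (x Subset.∈? C)
    in≢v : ∀ {x} → x ∈ C → x ≢ v
    in≢v x∈C refl = let i , eq = image⊆φ (C⊆image x∈C) in Fin.punchInᵢ≢i v _ eq
    outside : ∃[ b ] (b ≢ v × b ∉ C)
    outside with b , b∉φ ← missed k<N (proj₁ K) = punchIn v b , Fin.punchInᵢ≢i v b ,
      λ b∈C → let i , eq = image⊆φ (C⊆image b∈C) in b∉φ i (Fin.punchIn-injective v _ _ eq)
    leaving : ∀ {x y} → x ∈ C → y ∉ C → y ≢ v → Hued col (not κ) (v , x , y)
    leaving {x} {y} x∈C y∉C y≢v with d ← (in≢v x∈C ∘ sym) , (y≢v ∘ sym) , (λ { refl → y∉C x∈C })
      with hued-or col κ {v , x , y} d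
    ... | inj₁ h = contradiction (d , h) (closed x∈C y∉C)
    ... | inj₂ h = h
    opposite : ∀ x → ∃[ y ] y ≢ v × side x ≢ side y
    opposite x with x Subset.∈? C
    ... | yes _ = let b , b≢v , b∉C = outside in
      b , b≢v , λ eq → contradiction (trans eq (dec-false (b Subset.∈? C) b∉C)) λ ()
    ... | no  _ = a , in≢v a∈C , λ eq → contradiction (trans eq (dec-true (a Subset.∈? C) a∈C)) λ ()
    cross : ∀ {x y} → x ≢ v → y ≢ v → side x ≢ side y → Hued col (not κ) (v , x , y)
    cross {x} {y} x≢v y≢v x|y with x Subset.∈? C | y Subset.∈? C
    ... | yes x∈C | no y∉C  = leaving x∈C y∉C y≢v
    ... | no x∉C  | yes y∈C = swap₃ {col = col} (leaving y∈C x∉C x≢v)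
    ... | yes _   | yes _   = contradiction refl x|y
    ... | no _    | no _    = contradiction refl x|y

module _ {col : Colouring N} {v : Fin N} (red : Cut col true v) (blue : Cut col false v) where
  private
    module R = Cut red
    module B = Cut blue

  -- A pair crossing both cuts would form with `v` a triple of both colours.
  ¬both-cut : ∀ {x y} → x ≢ v → y ≢ v → R.side x ≢ R.side y → B.side x ≡ B.side y
  ¬both-cut {x} {y} x≢v y≢v x|y with B.side x Bool.≟ B.side y
  ... | yes eq = eq
  ... | no x∤y = contradiction (B.cross x≢v y≢v x∤y)
    (hued-exclusive col {v , x , y} (x≢v ∘ sym , y≢v ∘ sym , λ { refl → x|y refl }) (R.cross x≢v y≢v x|y))

  -- A blue-crossing pair x, y lies on one red side; any z on the other red side is then
  -- on the same blue side as both of them.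
  cuts-incompatible : ⊥
  cuts-incompatible with x , x≢v , _ ← R.opposite v
    with y , y≢v , x∤y ← B.opposite x with R.side x Bool.≟ R.side y
  ... | no x|y = x∤y (¬both-cut x≢v y≢v x|y)
  ... | yes eq with z , z≢v , x|z ← R.opposite x =
    x∤y (trans (¬both-cut x≢v z≢v x|z) (sym (¬both-cut y≢v z≢v (subst (_≢ R.side z) eq x|z))))

-- Both smaller copies are found after deleting the same vertex. If neither extends, the red one
-- yields a blue cut there and the blue one a red cut.
arrows-step : ∀ {n} → s < n → t < n → Arrows n s (suc t) → Arrows n (suc s) t → Arrows (suc n) (suc s) (suc t)
arrows-step {s} {t} {n} s<n t<n arr₁ arr₂ col = smaller (arr₁ (delete zero col)) (arr₂ (delete zero col))
  where
  Goal : Set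
  Goal = MonoBergeK (suc n) col true (suc s) ⊎ MonoBergeK (suc n) col false (suc t)
  larger : MonoBergeK (suc n) col true (suc s) ⊎ Cut col false zero →
           MonoBergeK (suc n) col false (suc t) ⊎ Cut col true zero → Goal
  larger (inj₁ red) _           = inj₁ red
  larger _ (inj₁ blue)          = inj₂ blue
  larger (inj₂ cut) (inj₂ cut′) = contradiction (cuts-incompatible cut′ cut) λ ()
  smaller : MonoBergeK n (delete zero col) true s ⊎ MonoBergeK n (delete zero col) false (suc t) →
            MonoBergeK n (delete zero col) true (suc s) ⊎ MonoBergeK n (delete zero col) false t → Goal
  smaller (inj₂ blue) _          = inj₂ (undelete col zero blue)
  smaller _ (inj₁ red)           = inj₁ (undelete col zero red)
  smaller (inj₁ red) (inj₂ blue) = larger (extend-or-cut col zero s<n red) (extend-or-cut col zero t<n blue)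

-- Red K₃ and K₄ from red cuts at all vertices

fresh : ∀ (xs : Vec (Fin N) k) → k < N → ∃[ v ] (∀ i → lookup xs i ≢ v)
fresh xs k<N = missed k<N (lookup xs)

module _ {N : ℕ} (col : Colouring N) where

  Red Blue : Fin N → Fin N → Fin N → Set
  Red  a b c = Hued col true (a , b , c)
  Blue a b c = Hued col false (a , b , c)

  swap : ∀ {a b c} → Hued col κ (a , b , c) → Hued col κ (a , c , b)
  swap = swap₃ {col = col}

  rotate : ∀ {a b c} → Hued col κ (a , b , c) → Hued col κ (b , c , a)
  rotate = rotate₃ {col = col}

  -- The extreme form of a red cut at `a`, with `b` alone on one side.
  record Full (a b : Fin N) : Set where
    field
      distinct : a ≢ b
      red      : ∀ {x} → x ≢ a → x ≢ b → Red a b x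

  full-sym : ∀ {a b} → Full a b → Full b a
  full-sym F = record { distinct = distinct ∘ sym ; red = λ x≢b x≢a → swap (rotate (red x≢a x≢b)) }
    where open Full F

  -- Both sides have at least two vertices, so the red link of `v` contains a 4-cycle.
  record Square (v : Fin N) : Set where
    field
      cut  : Cut col true v
      mate : ∀ {x} → x ≢ v → ∃[ y ] y ≢ v × x ≢ y × Cut.side cut x ≡ Cut.side cut y
    open Cut cut public

    apart : ∀ {x y} → side x ≢ side y → x ≢ y
    apart x|y refl = x|y refl

    across : ∀ {x y z} → side x ≡ side y → side x ≢ side z → side y ≢ side z
    across {z = z} = subst (_≢ side z)

  -- A vertex `x` without a mate is alone on its side, so every pair of `x` and another vertex
  -- crosses the cut.
  full-or-square : ∀ {v} → Cut col true v → (∃[ a ] Full v a) ⊎ Square v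
  full-or-square {v} cut = decide (any? λ x → ¬? (x ≟ v) ×-dec ¬? (mate? x))
    where
    open Cut cut
    Mate : Fin N → Fin N → Set
    Mate x y = y ≢ v × x ≢ y × side x ≡ side y
    mate? : ∀ x → Dec (∃ (Mate x))
    mate? x = any? λ y → ¬? (y ≟ v) ×-dec ¬? (x ≟ y) ×-dec (side x Bool.≟ side y)
    decide : Dec (∃ λ x → x ≢ v × ¬ ∃ (Mate x)) → (∃[ a ] Full v a) ⊎ Square v
    decide (yes (x , x≢v , alone)) = inj₁ (x , record
      { distinct = x≢v ∘ sym
      ; red = λ {y} y≢v y≢x → cross x≢v y≢v λ eq → alone (y , y≢v , y≢x ∘ sym , eq) })
    decide (no none) = inj₂ (record
      { cut = cut
      ; mate = λ {x} x≢v → decidable-stable (mate? x) λ alone → none (x , x≢v , alone) })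

  BK : ℕ → Set
  BK = MonoBergeK N col true

  -- The core is `v`, `a`, `b`, with `a`, `a′` on one side and `b`, `b′` on the other. Third
  -- vertices: `b′` for `v a`, `a′` for `v b`, and `v` for `a b`.
  square⇒BK₃ : ∀ {v} → Square v → BK 3
  square⇒BK₃ {v} S
    with a , a≢v , _ ← Square.opposite S v
    with b , b≢v , a|b ← Square.opposite S a
    with a′ , a′≢v , a≢a′ , a~a′ ← Square.mate S a≢v
    with b′ , b′≢v , b≢b′ , b~b′ ← Square.mate S b≢v
    = berge {col = col} {f = lookup (v ∷ a ∷ b ∷ a′ ∷ b′ ∷ [])}
        (lookup-injective
          ( (a≢v ∘ sym ∷ b≢v ∘ sym ∷ a′≢v ∘ sym ∷ b′≢v ∘ sym ∷ [])
          ∷ (apart a|b ∷ a≢a′ ∷ apart a|b′ ∷ [])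
          ∷ (apart (a′|b ∘ sym) ∷ b≢b′ ∷ [])
          ∷ (apart (across a~a′ a|b′) ∷ [])
          ∷ [] ∷ []))
        (0F ⟪ 4F ∷ 3F ∷ [] ⟫ 1F ⟪ 0F ∷ [] ⟫ 2F ⟪ [] ⟫ ∅)
        ( cross a≢v b′≢v a|b′
        ∷ cross b≢v a′≢v (a′|b ∘ sym)
        ∷ rotate (cross a≢v b≢v a|b)
        ∷ [])
    where
    open Square S
    a|b′ : side a ≢ side b′
    a|b′ = subst (side a ≢_) b~b′ a|b
    a′|b : side a′ ≢ side b
    a′|b = across a~a′ a|b

  adjacentFulls⇒BK₃ : ∀ {x y z} → 3 < N → Full y x → Full y z → x ≢ z → BK 3
  adjacentFulls⇒BK₃ {x} {y} {z} 3<N F G x≢z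
    with w , w∉ ← fresh (y ∷ x ∷ z ∷ []) 3<N
    = berge {col = col} {f = lookup (y ∷ x ∷ z ∷ w ∷ [])}
        (lookup-injective
          ( (F.distinct ∷ G.distinct ∷ w∉ 0F ∷ [])
          ∷ (x≢z ∷ w∉ 1F ∷ [])
          ∷ (w∉ 2F ∷ [])
          ∷ [] ∷ []))
        (0F ⟪ 3F ∷ 3F ∷ [] ⟫ 1F ⟪ 0F ∷ [] ⟫ 2F ⟪ [] ⟫ ∅)
        ( F.red (w∉ 0F ∘ sym) (w∉ 1F ∘ sym)
        ∷ G.red (w∉ 0F ∘ sym) (w∉ 2F ∘ sym)
        ∷ rotate (F.red (G.distinct ∘ sym) (x≢z ∘ sym))
        ∷ [])
    where
    module F = Full F
    module G = Full G

  -- All triples within `x`, `y`, `z`, `w` contain one of the two full pairs, hence are red; three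
  -- of them suffice.
  disjointFulls⇒BK₃ : ∀ {x y z w} → Full x y → Full z w → x ≢ z → x ≢ w → y ≢ z → y ≢ w → BK 3
  disjointFulls⇒BK₃ {x} {y} {z} {w} F G x≢z x≢w y≢z y≢w
    = berge {col = col} {f = lookup (x ∷ y ∷ z ∷ w ∷ [])}
        (lookup-injective
          ( (F.distinct ∷ x≢z ∷ x≢w ∷ [])
          ∷ (y≢z ∷ y≢w ∷ [])
          ∷ (G.distinct ∷ [])
          ∷ [] ∷ []))
        (0F ⟪ 3F ∷ 1F ∷ [] ⟫ 1F ⟪ 3F ∷ [] ⟫ 2F ⟪ [] ⟫ ∅)
        ( F.red (x≢w ∘ sym) (y≢w ∘ sym)
        ∷ swap (F.red (x≢z ∘ sym) (y≢z ∘ sym))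
        ∷ rotate (rotate (G.red y≢z y≢w))
        ∷ [])
    where
    module F = Full F
    module G = Full G

  -- Without a square, every vertex lies in a full pair. A full pair and one through a vertex
  -- outside it either share a vertex or are disjoint.
  cuts⇒BK₃ : 3 < N → (∀ v → Cut col true v) → BK 3
  cuts⇒BK₃ 3<N cuts with v , _ ← fresh [] (ℕ.≤-trans (s≤s z≤n) 3<N) = start (full-or-square (cuts v))
    where
    second : ∀ {v a u} → Full v a → v ≢ u → a ≢ u → (∃[ b ] Full u b) ⊎ Square u → BK 3
    second F v≢u a≢u (inj₂ S) = square⇒BK₃ S
    second {v} {a} F v≢u a≢u (inj₁ (b , G)) with b ≟ v | b ≟ a
    ... | yes refl | _      = adjacentFulls⇒BK₃ 3<N F (full-sym G) a≢u
    ... | no _ | yes refl   = adjacentFulls⇒BK₃ 3<N (full-sym F) (full-sym G) v≢u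
    ... | no b≢v | no b≢a   = disjointFulls⇒BK₃ F G v≢u (b≢v ∘ sym) a≢u (b≢a ∘ sym)
    start : ∀ {v} → (∃[ a ] Full v a) ⊎ Square v → BK 3
    start (inj₂ S) = square⇒BK₃ S
    start {v} (inj₁ (a , F)) with u , u∉ ← fresh (v ∷ a ∷ []) (ℕ.≤-trans (s≤s (s≤s (s≤s z≤n))) 3<N) =
      second F (u∉ 0F) (u∉ 1F) (full-or-square (cuts u))

  -- The red link of `v` is exactly the complete bipartite graph between the sides.
  record Bip (v : Fin N) : Set where
    field
      square : Square v
    open Square square public
    field
      inner : ∀ {x y} → x ≢ v → y ≢ v → x ≢ y → side x ≡ side y → Blue v x y

    red⇒across : ∀ {x y} → x ≢ v → y ≢ v → x ≢ y → Red v x y → side x ≢ side y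
    red⇒across {x} {y} x≢v y≢v x≢y red eq =
      hued-exclusive col {v , x , y} (x≢v ∘ sym , y≢v ∘ sym , x≢y) red (inner x≢v y≢v x≢y eq)

    blue⇒inner : ∀ {x y} → x ≢ v → y ≢ v → x ≢ y → Blue v x y → side x ≡ side y
    blue⇒inner {x} {y} x≢v y≢v x≢y blue = decidable-stable (side x Bool.≟ side y) λ x|y →
      hued-exclusive col {v , x , y} (x≢v ∘ sym , y≢v ∘ sym , x≢y) (cross x≢v y≢v x|y) blue

  -- The core is `v`, `x`, `y`, `p`, with `p`, `q` on the other side. The pairs among `x`, `y`, `p`
  -- use `v`; those of `v` with `x` and `y` use `q`, and that with `p` uses `z`.
  chord⇒BK₄ : ∀ {v x y z} (S : Square v) → x ≢ v → y ≢ v → z ≢ v →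
    x ≢ y → x ≢ z → y ≢ z → Square.side S x ≡ Square.side S y → Square.side S x ≡ Square.side S z → Red v x y → BK 4
  chord⇒BK₄ {v} {x} {y} {z} S x≢v y≢v z≢v x≢y x≢z y≢z x~y x~z red
    with p , p≢v , x|p ← Square.opposite S x
    with q , q≢v , p≢q , p~q ← Square.mate S p≢v
    = berge {col = col} {f = lookup (v ∷ x ∷ y ∷ p ∷ q ∷ z ∷ [])}
        (lookup-injective
          ( (x≢v ∘ sym ∷ y≢v ∘ sym ∷ p≢v ∘ sym ∷ q≢v ∘ sym ∷ z≢v ∘ sym ∷ [])
          ∷ (x≢y ∷ apart x|p ∷ apart x|q ∷ x≢z ∷ [])
          ∷ (apart (across x~y x|p) ∷ apart (across x~y x|q) ∷ y≢z ∷ [])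
          ∷ (p≢q ∷ apart p|z ∷ [])
          ∷ (apart (across p~q p|z) ∷ [])
          ∷ [] ∷ []))
        (0F ⟪ 4F ∷ 4F ∷ 5F ∷ [] ⟫ 1F ⟪ 0F ∷ 0F ∷ [] ⟫ 2F ⟪ 0F ∷ [] ⟫ 3F ⟪ [] ⟫ ∅)
        ( cross x≢v q≢v x|q
        ∷ cross y≢v q≢v (across x~y x|q)
        ∷ cross p≢v z≢v p|z
        ∷ rotate red
        ∷ rotate (cross x≢v p≢v x|p)
        ∷ rotate (cross y≢v p≢v (across x~y x|p))
        ∷ [])
    where
    open Square S
    x|q : side x ≢ side q
    x|q = subst (side x ≢_) p~q x|p
    p|z : side p ≢ side z
    p|z = across x~z x|p ∘ sym

  Type : Fin N → Set
  Type v = BK 4 ⊎ (∃[ a ] Full v a) ⊎ Bip v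

  -- If a red link edge `x y` lies inside a side, a third vertex of that side gives K₄. Otherwise
  -- the side consists of `x` and `y`, and `x` is red with `y` as well as across, so `v x` is full.
  classify : ∀ {v} → Square v → Type v
  classify {v} S = decide (any? λ x → any? λ y → (side x Bool.≟ side y) ×-dec edge? col true (v , x , y))
    where
    open Square S
    Third : Fin N → Fin N → Set
    Third x y = ∃[ z ] z ≢ v × x ≢ z × y ≢ z × side x ≡ side z
    third? : ∀ x y → Dec (Third x y)
    third? x y = any? λ z → ¬? (z ≟ v) ×-dec ¬? (x ≟ z) ×-dec ¬? (y ≟ z) ×-dec (side x Bool.≟ side z)
    chord : ∀ {x y} → Distinct (v , x , y) → side x ≡ side y → Red v x y → Dec (Third x y) → Type v
    chord (v≢x , v≢y , x≢y) x~y red (yes (z , z≢v , x≢z , y≢z , x~z)) =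
      inj₁ (chord⇒BK₄ S (v≢x ∘ sym) (v≢y ∘ sym) z≢v x≢y x≢z y≢z x~y x~z red)
    chord {x} {y} (v≢x , _) x~y red (no none) = inj₂ (inj₁ (x , record
      { distinct = v≢x ; red = λ {w} w≢v w≢x → full w≢v w≢x (w ≟ y) }))
      where
      full : ∀ {w} → w ≢ v → w ≢ x → Dec (w ≡ y) → Red v x w
      full w≢v w≢x (yes refl) = red
      full w≢v w≢x (no w≢y) = cross (v≢x ∘ sym) w≢v λ eq → none (_ , w≢v , w≢x ∘ sym , w≢y ∘ sym , eq)
    decide : Dec (∃ λ x → ∃ λ y → side x ≡ side y × Distinct (v , x , y) × Red v x y) → Type v
    decide (yes (x , y , x~y , d , red)) = chord d x~y red (third? x y)
    decide (no none) = inj₂ (inj₂ (record { square = S ; inner = inner }))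
      where
      inner : ∀ {x y} → x ≢ v → y ≢ v → x ≢ y → side x ≡ side y → Blue v x y
      inner {x} {y} x≢v y≢v x≢y x~y with d ← (x≢v ∘ sym , y≢v ∘ sym , x≢y) with hued-either col {v , x , y} d
      ... | inj₁ red  = contradiction (_ , _ , x~y , d , red) none
      ... | inj₂ blue = blue

  -- The four triples within `x`, `y`, `z`, `w` are red and serve the four mixed pairs; `q` serves
  -- the two full pairs.
  disjointFulls⇒BK₄ : ∀ {x y z w} → 4 < N → Full x y → Full z w → x ≢ z → x ≢ w → y ≢ z → y ≢ w → BK 4
  disjointFulls⇒BK₄ {x} {y} {z} {w} 4<N F G x≢z x≢w y≢z y≢w
    with q , q∉ ← fresh (x ∷ y ∷ z ∷ w ∷ []) 4<N
    = berge {col = col} {f = lookup (x ∷ y ∷ z ∷ w ∷ q ∷ [])}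
        (lookup-injective
          ( (F.distinct ∷ x≢z ∷ x≢w ∷ q∉ 0F ∷ [])
          ∷ (y≢z ∷ y≢w ∷ q∉ 1F ∷ [])
          ∷ (G.distinct ∷ q∉ 2F ∷ [])
          ∷ (q∉ 3F ∷ [])
          ∷ [] ∷ []))
        (0F ⟪ 4F ∷ 1F ∷ 2F ∷ [] ⟫ 1F ⟪ 3F ∷ 0F ∷ [] ⟫ 2F ⟪ 4F ∷ [] ⟫ 3F ⟪ [] ⟫ ∅)
        ( F.red (q∉ 0F ∘ sym) (q∉ 1F ∘ sym)
        ∷ swap (F.red (x≢z ∘ sym) (y≢z ∘ sym))
        ∷ swap (rotate (rotate (G.red x≢z x≢w)))
        ∷ rotate (rotate (G.red y≢z y≢w))
        ∷ rotate (F.red (x≢w ∘ sym) (y≢w ∘ sym))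
        ∷ G.red (q∉ 2F ∘ sym) (q∉ 3F ∘ sym)
        ∷ [])
    where
    module F = Full F
    module G = Full G

  -- The pairs at the centre `y` use `q`, the remaining ones use `y`.
  fullStar⇒BK₄ : ∀ {x y z w} → 4 < N → Full y x → Full y z → Full y w → x ≢ z → x ≢ w → z ≢ w → BK 4
  fullStar⇒BK₄ {x} {y} {z} {w} 4<N F G H x≢z x≢w z≢w
    with q , q∉ ← fresh (y ∷ x ∷ z ∷ w ∷ []) 4<N
    = berge {col = col} {f = lookup (y ∷ x ∷ z ∷ w ∷ q ∷ [])}
        (lookup-injective
          ( (F.distinct ∷ G.distinct ∷ H.distinct ∷ q∉ 0F ∷ [])
          ∷ (x≢z ∷ x≢w ∷ q∉ 1F ∷ [])
          ∷ (z≢w ∷ q∉ 2F ∷ [])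
          ∷ (q∉ 3F ∷ [])
          ∷ [] ∷ []))
        (0F ⟪ 4F ∷ 4F ∷ 4F ∷ [] ⟫ 1F ⟪ 0F ∷ 0F ∷ [] ⟫ 2F ⟪ 0F ∷ [] ⟫ 3F ⟪ [] ⟫ ∅)
        ( F.red (q∉ 0F ∘ sym) (q∉ 1F ∘ sym)
        ∷ G.red (q∉ 0F ∘ sym) (q∉ 2F ∘ sym)
        ∷ H.red (q∉ 0F ∘ sym) (q∉ 3F ∘ sym)
        ∷ rotate (F.red (G.distinct ∘ sym) (x≢z ∘ sym))
        ∷ rotate (F.red (H.distinct ∘ sym) (x≢w ∘ sym))
        ∷ rotate (G.red (H.distinct ∘ sym) (z≢w ∘ sym))
        ∷ [])
    where
    module F = Full F
    module G = Full G
    module H = Full H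

  -- The triple `u`, `v`, `a` is red, so `v` and `a` lie on different sides at `u`, and mates `x` of
  -- `v` and `b` of `a` complete a 4-cycle. Its edges serve the pairs at `u` and `v b`; the full
  -- pair serves `v a` and `a b`.
  full+bip⇒BK₄ : ∀ {v a u} → Full v a → Bip u → v ≢ u → a ≢ u → BK 4
  full+bip⇒BK₄ {v} {a} {u} F P v≢u a≢u
    with x , x≢u , v≢x , v~x ← Bip.mate P v≢u
    with b , b≢u , a≢b , a~b ← Bip.mate P a≢u
    = berge {col = col} {f = lookup (u ∷ v ∷ a ∷ b ∷ x ∷ [])}
        (lookup-injective
          ( (v≢u ∘ sym ∷ a≢u ∘ sym ∷ b≢u ∘ sym ∷ x≢u ∘ sym ∷ [])
          ∷ (distinct ∷ apart v|b ∷ v≢x ∷ [])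
          ∷ (a≢b ∷ apart (across v~x v|a ∘ sym) ∷ [])
          ∷ (apart (across v~x v|b ∘ sym) ∷ [])
          ∷ [] ∷ []))
        (0F ⟪ 2F ∷ 4F ∷ 4F ∷ [] ⟫ 1F ⟪ 4F ∷ 0F ∷ [] ⟫ 2F ⟪ 1F ∷ [] ⟫ 3F ⟪ [] ⟫ ∅)
        ( cross v≢u a≢u v|a
        ∷ cross a≢u x≢u (across v~x v|a ∘ sym)
        ∷ cross b≢u x≢u (across v~x v|b ∘ sym)
        ∷ red (v≢x ∘ sym) (apart (across v~x v|a))
        ∷ rotate (cross v≢u b≢u v|b)
        ∷ rotate (red (apart v|b ∘ sym) (a≢b ∘ sym))
        ∷ [])
    where
    open Full F
    open Bip P
    v|a : side v ≢ side a
    v|a = red⇒across v≢u a≢u distinct (rotate (rotate (red (v≢u ∘ sym) (a≢u ∘ sym))))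
    v|b : side v ≢ side b
    v|b = subst (side v ≢_) a~b v|a

  -- With a mate of `a`, the pair `v a` forms a triple that is blue by the bipartition and red by
  -- fullness.
  ¬full-at-bip : ∀ {v a} → Bip v → ¬ Full v a
  ¬full-at-bip {v} {a} P F with a′ , a′≢v , a≢a′ , a~a′ ← Bip.mate P (Full.distinct F ∘ sym) =
    red⇒across (distinct ∘ sym) a′≢v a≢a′ (red a′≢v (a≢a′ ∘ sym)) a~a′
    where
    open Full F
    open Bip P

  -- If a and b lie on different sides of v and b′ is a mate of b, then {a, b, b′} is blue by the
  -- bipartition at a, but red by the one at b.
  ¬three-bips : ∀ {v a b} (P : Bip v) → a ≢ v → b ≢ v → Bip.side P a ≢ Bip.side P b → Bip a → ¬ Bip b
  ¬three-bips {v} {a} {b} P a≢v b≢v a|b Pa Pb with b′ , b′≢v , b≢b′ , b~b′ ← Bip.mate P b≢v =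
    hued-exclusive col {b , a , b′} (a≢b ∘ sym , b≢b′ , a≢b′) red (swap (rotate blue))
    where
    module V = Bip P
    module A = Bip Pa
    module B = Bip Pb
    a≢b : a ≢ b
    a≢b = V.apart a|b
    a|b′ : V.side a ≢ V.side b′
    a|b′ = subst (V.side a ≢_) b~b′ a|b
    a≢b′ : a ≢ b′
    a≢b′ = V.apart a|b′
    v|ₐ : ∀ {x} → a ≢ x → x ≢ v → V.side a ≢ V.side x → A.side v ≢ A.side x
    v|ₐ a≢x x≢v a|x = A.red⇒across (a≢v ∘ sym) (a≢x ∘ sym) (x≢v ∘ sym) (swap (rotate (V.cross a≢v x≢v a|x)))
    -- At `a`, both `b` and `b′` are separated from `v`, hence they are on one side.
    blue : Blue a b b′
    blue = A.inner (a≢b ∘ sym) (a≢b′ ∘ sym) b≢b′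
      (trans (Bool.¬-not (v|ₐ a≢b b≢v a|b ∘ sym)) (sym (Bool.¬-not (v|ₐ a≢b′ b′≢v a|b′ ∘ sym))))
    -- At `b`, the vertex `v` is opposite `a`, as `v`, `a`, `b` is red, and on the side of `b′`, as
    -- `v`, `b`, `b′` is blue.
    red : Red b a b′
    red = B.cross a≢b (b≢b′ ∘ sym) λ eq →
      B.red⇒across (b≢v ∘ sym) a≢b (a≢v ∘ sym) (rotate (rotate (V.cross a≢v b≢v a|b)))
        (trans (B.blue⇒inner (b≢v ∘ sym) (b≢b′ ∘ sym) (b′≢v ∘ sym) (swap (rotate (V.inner b≢v b′≢v b≢b′ b~b′)))) (sym eq))

  -- A full pair excludes a bipartition at any vertex outside it, unless K₄ appears. So one full
  -- pair leads to further ones, among which two are disjoint or three form a star. Starting from a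
  -- bipartition, two vertices on different sides must have bipartitions too, which is
  -- contradictory.
  cuts⇒BK₄ : 4 < N → (∀ v → Cut col true v) → BK 4
  cuts⇒BK₄ 4<N cuts with v , _ ← fresh [] (ℕ.≤-trans (s≤s z≤n) 4<N) = start (type v)
    where
    type : ∀ v → Type v
    type v = [ inj₂ ∘ inj₁ , classify ]′ (full-or-square (cuts v))

    third : ∀ {x y z w} → Full y x → Full y z → x ≢ z → y ≢ w → x ≢ w → z ≢ w → Type w → BK 4
    third F G x≢z y≢w x≢w z≢w (inj₁ K)        = K
    third F G x≢z y≢w x≢w z≢w (inj₂ (inj₂ P)) = full+bip⇒BK₄ F P y≢w x≢w
    third {x} {y} {z} F G x≢z y≢w x≢w z≢w (inj₂ (inj₁ (b , H))) with b ≟ y | b ≟ x | b ≟ z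
    ... | yes refl | _ | _ = fullStar⇒BK₄ 4<N F G (full-sym H) x≢z x≢w z≢w
    ... | no _ | yes refl | _ = disjointFulls⇒BK₄ 4<N G H y≢w (Full.distinct F) z≢w (x≢z ∘ sym)
    ... | no _ | no _ | yes refl = disjointFulls⇒BK₄ 4<N F H y≢w (Full.distinct G) x≢w x≢z
    ... | no b≢y | no b≢x | no _ = disjointFulls⇒BK₄ 4<N F H y≢w (b≢y ∘ sym) x≢w (b≢x ∘ sym)

    adjacent : ∀ {x y z} → Full y x → Full y z → x ≢ z → BK 4
    adjacent {x} {y} {z} F G x≢z with w , w∉ ← fresh (y ∷ x ∷ z ∷ []) (ℕ.<⇒≤ 4<N) =
      third F G x≢z (w∉ 0F) (w∉ 1F) (w∉ 2F) (type w)

    second : ∀ {v a u} → Full v a → v ≢ u → a ≢ u → Type u → BK 4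
    second F v≢u a≢u (inj₁ K)        = K
    second F v≢u a≢u (inj₂ (inj₂ P)) = full+bip⇒BK₄ F P v≢u a≢u
    second {v} {a} F v≢u a≢u (inj₂ (inj₁ (b , G))) with b ≟ v | b ≟ a
    ... | yes refl | _    = adjacent F (full-sym G) a≢u
    ... | no _ | yes refl = adjacent (full-sym F) (full-sym G) v≢u
    ... | no b≢v | no b≢a = disjointFulls⇒BK₄ 4<N F G v≢u (b≢v ∘ sym) a≢u (b≢a ∘ sym)

    neighbour : ∀ {v a} → Bip v → a ≢ v → Type a → BK 4 ⊎ Bip a
    neighbour P a≢v (inj₁ K)        = inj₁ K
    neighbour P a≢v (inj₂ (inj₂ Q)) = inj₂ Q
    neighbour {v} P a≢v (inj₂ (inj₁ (b , F))) with b ≟ v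
    ... | yes refl = contradiction (full-sym F) (¬full-at-bip P)
    ... | no b≢v   = inj₁ (full+bip⇒BK₄ F P a≢v b≢v)

    start : ∀ {v} → Type v → BK 4
    start (inj₁ K) = K
    start {v} (inj₂ (inj₁ (a , F))) with u , u∉ ← fresh (v ∷ a ∷ []) (ℕ.≤-trans (s≤s (s≤s (s≤s z≤n))) 4<N) =
      second F (u∉ 0F) (u∉ 1F) (type u)
    start {v} (inj₂ (inj₂ P))
      with a , a≢v , _ ← Bip.opposite P v
      with b , b≢v , a|b ← Bip.opposite P a
      with neighbour P a≢v (type a) | neighbour P b≢v (type b)
    ... | inj₁ K | _ = K
    ... | _ | inj₁ K = K
    ... | inj₂ Pa | inj₂ Pb = contradiction Pb (¬three-bips P a≢v b≢v a|b Pa)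

-- Upper bounds in general

choose : ∀ {P : Fin k → Set} → (∀ v → A ⊎ P v) → A ⊎ (∀ v → P v)
choose {zero}  f = inj₂ λ ()
choose {suc k} f with f zero | choose (f ∘ suc)
... | inj₁ a | _      = inj₁ a
... | _ | inj₁ a      = inj₁ a
... | inj₂ p | inj₂ q = inj₂ λ { zero → p ; (suc v) → q v }

all-cuts : ∀ {n} → t < n → Arrows n s t → (col : Colouring (suc n)) →
  (MonoBergeK (suc n) col true s ⊎ MonoBergeK (suc n) col false (suc t)) ⊎ (∀ v → Cut col true v)
all-cuts {t} {s} {n} t<n arr col = choose (λ v → at v (arr (delete v col)))
  where
  Goal : Set
  Goal = MonoBergeK (suc n) col true s ⊎ MonoBergeK (suc n) col false (suc t)
  at : ∀ v → MonoBergeK n (delete v col) true s ⊎ MonoBergeK n (delete v col) false t → Goal ⊎ Cut col true v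
  at v (inj₁ red)  = inj₁ (inj₁ (undelete col v red))
  at v (inj₂ blue) = Sum.map₁ inj₂ (extend-or-cut col v t<n blue)

-- The smaller blue core leaves no vertex outside it, so `extend-or-cut` does not apply. The link
-- edges are chosen explicitly, and a red one among them is already a red Berge K₂.
arrows-2-t : ∀ j → Arrows (5 + j) 2 (5 + j)
arrows-2-t zero    = arrows-5-2-5
arrows-2-t (suc j) col = smaller (arrows-2-t j (delete zero col))
  where
  -- The cycle 0, 1, 2 with everything else sent to 0 has no fixed point and no 2-cycle.
  next : Fin (5 + j) → Fin (5 + j)
  next 0F            = 1F
  next 1F            = 2F
  next (suc (suc _)) = 0F
  next-irreflexive : ∀ i → next i ≢ i
  next-irreflexive 0F            ()
  next-irreflexive 1F            ()
  next-irreflexive (suc (suc _)) ()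
  next-acyclic : ∀ i → next (next i) ≢ i
  next-acyclic 0F                  ()
  next-acyclic 1F                  ()
  next-acyclic 2F                  ()
  next-acyclic (suc (suc (suc _))) ()

  smaller : MonoBergeK (5 + j) (delete zero col) true 2 ⊎ MonoBergeK (5 + j) (delete zero col) false (5 + j) →
    MonoBergeK (6 + j) col true 2 ⊎ MonoBergeK (6 + j) col false (6 + j)
  smaller (inj₁ red) = inj₁ (undelete col zero red)
  smaller (inj₂ K) = Sum.map id extend (choose edge)
    where
    φ h : Fin (5 + j) → Fin (6 + j)
    φ i = suc (proj₁ K i)
    h i = φ (next i)
    φ-inj : Inj φ
    φ-inj i i′ eq = proj₁ (proj₂ (proj₂ K)) i i′ (Fin.suc-injective eq)
    distinct : ∀ i → Distinct (zero , φ i , h i)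
    distinct i = (λ ()) , (λ ()) , λ eq → next-irreflexive i (sym (φ-inj _ _ eq))
    edge : ∀ i → MonoBergeK (6 + j) col true 2 ⊎ Hued col false (zero , φ i , h i)
    edge i = Sum.map₁ (single i) (hued-either col (distinct i))
      where
      single : ∀ i → Hued col true (zero , φ i , h i) → MonoBergeK (6 + j) col true 2
      single i red = let 0≢φ , 0≢h , φ≢h = distinct i in
        berge {col = col} {f = lookup (zero ∷ φ i ∷ h i ∷ [])}
          (lookup-injective ((0≢φ ∷ 0≢h ∷ []) ∷ (φ≢h ∷ []) ∷ [] ∷ []))
          (0F ⟪ 2F ∷ [] ⟫ 1F ⟪ [] ⟫ ∅) (red ∷ [])
    extend : (∀ i → Hued col false (zero , φ i , h i)) → MonoBergeK (6 + j) col false (6 + j)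
    extend blue = attach col zero K h (λ i → distinct i , blue i)
      λ i i′ eq eq′ → next-acyclic i (trans (cong next (φ-inj _ _ eq)) (φ-inj _ _ eq′))

arrows-3-t : ∀ j → Arrows (5 + j) 3 (4 + j)
arrows-3-t zero = arrows-5-3-4
arrows-3-t (suc j) col =
  [ id , inj₁ ∘ cuts⇒BK₃ col (s≤s (s≤s (s≤s (s≤s z≤n)))) ]′ (all-cuts (ℕ.n<1+n _) (arrows-3-t j) col)

arrows-4-t : ∀ j → Arrows (6 + j) 4 (5 + j)
arrows-4-t zero = arrows-6-4-5
arrows-4-t (suc j) col =
  [ id , inj₁ ∘ cuts⇒BK₄ col (s≤s (s≤s (s≤s (s≤s (s≤s z≤n))))) ]′ (all-cuts (ℕ.n<1+n _) (arrows-4-t j) col)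

-- Induction on `i`, and on `j` inside. For `j = 0` the step needs the blue K₄ bound, which is
-- `arrows-4-t` with the colours exchanged.
arrows-s-t : ∀ i j → Arrows (6 + i + j) (4 + i) (5 + j)
arrows-s-t zero    j = arrows-4-t j
arrows-s-t (suc i) j = arrows-step (ℕ.m≤n⇒m≤1+n (ℕ.m≤m+n (5 + i) j)) (ℕ.+-monoʳ-≤ 5 (ℕ.m≤n⇒m≤1+n (ℕ.m≤n+m j i)))
  (arrows-s-t i j) (smaller-t j)
  where
  smaller-t : ∀ j → Arrows (6 + i + j) (5 + i) (4 + j)
  smaller-t zero    = subst (λ n → Arrows n (5 + i) 4) (sym (ℕ.+-identityʳ (6 + i))) (arrows-sym (arrows-4-t i))
  smaller-t (suc j) = subst (λ n → Arrows n (5 + i) (5 + j)) (sym (ℕ.+-suc (6 + i) j)) (arrows-s-t (suc i) j)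

-- Lower bounds

does-true : ∀ (a? : Dec A) → does a? ≡ true → A
does-true (yes a) _ = a

does-false : ∀ (a? : Dec A) → does a? ≡ false → ¬ A
does-false (no ¬a) _ = ¬a

-- At most one core vertex lies outside `P`, so at least `1 + n` have distinct codes among `n`.
avoid-bound : ∀ {n} {P : Fin N → Set} (P? : ∀ x → Dec (P x)) (code : ∀ {x} → P x → Fin n) →
  (∀ {x y} (p : P x) (q : P y) → code p ≡ code q → x ≡ y) →
  (φ : Fin (2 + n) → Fin N) → Inj φ → ¬ (∀ {i j} → i ≢ j → P (φ i) ⊎ P (φ j))
avoid-bound P? code code-inj φ φ-inj cover with any? (λ i → ¬? (P? (φ i)))
... | no none = Fin.<⇒notInjective (ℕ.m≤n⇒m≤1+n (ℕ.n<1+n _))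
  (λ {i} {j} eq → φ-inj i j (code-inj (inP i) (inP j) eq))
  where
  inP : ∀ i → _
  inP i = decidable-stable (P? (φ i)) λ i∉P → none (i , i∉P)
... | yes (i₀ , i₀∉P) = Fin.<⇒notInjective (ℕ.n<1+n _)
  (λ {i} {j} eq → Fin.punchIn-injective i₀ i j (φ-inj _ _ (code-inj (inP i) (inP j) eq)))
  where
  inP : ∀ i → _
  inP i = [ (λ p → contradiction p i₀∉P) , id ]′ (cover {i₀} {punchIn i₀ i} (Fin.punchInᵢ≢i i₀ i ∘ sym))

pair-⊆ : ∀ {col : Colouring N} ((φ , ψ , _) : MonoBergeK N col κ k) {i j} → i ≢ j →
  ∃[ p ] φ i ∈ₑ ψ p × φ j ∈ₑ ψ p
pair-⊆ (φ , ψ , _ , _ , ⊆ψ , _) {i} {j} i≢j with Fin.<-cmp i j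
... | tri< i<j _ _ = ((i , j) , i<j) , ⊆ψ _
... | tri≈ _ i≡j _ = contradiction i≡j i≢j
... | tri> _ _ j<i = ((j , i) , j<i) , Product.swap (⊆ψ ((j , i) , j<i))

-- Of two vertices of a red triple one is below `a`, of two vertices of a blue triple one is not. So
-- all but one of the vertices of a core lie among `a`, respectively `b`, vertices.
¬arrows-threshold : ∀ a b → ¬ Arrows (a + b) (2 + a) (2 + b)
¬arrows-threshold a b arr = [ ¬red , ¬blue ]′ (arr col)
  where
  middle : Triple (a + b) → Fin (a + b)
  middle ((_ , y , _) , _) = y
  -- A triple x < y < z meets {0, …, a - 1} in at least two vertices iff y < a.
  col : Colouring (a + b)
  col e = does (toℕ (middle e) <? a)
  ≤middle : ∀ e {x y} → x ∈ₑ e → y ∈ₑ e → x ≢ y → x ≤ᶠ middle e ⊎ y ≤ᶠ middle e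
  ≤middle (_ , p<q , _) (inj₁ refl) _ _ = inj₁ (ℕ.<⇒≤ p<q)
  ≤middle _ (inj₂ (inj₁ refl)) _ _ = inj₁ ℕ.≤-refl
  ≤middle (_ , p<q , _) _ (inj₁ refl) _ = inj₂ (ℕ.<⇒≤ p<q)
  ≤middle _ _ (inj₂ (inj₁ refl)) _ = inj₂ ℕ.≤-refl
  ≤middle _ (inj₂ (inj₂ refl)) (inj₂ (inj₂ refl)) x≢y = contradiction refl x≢y
  ≥middle : ∀ e {x y} → x ∈ₑ e → y ∈ₑ e → x ≢ y → middle e ≤ᶠ x ⊎ middle e ≤ᶠ y
  ≥middle (_ , _ , q<r) (inj₂ (inj₂ refl)) _ _ = inj₁ (ℕ.<⇒≤ q<r)
  ≥middle _ (inj₂ (inj₁ refl)) _ _ = inj₁ ℕ.≤-refl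
  ≥middle (_ , _ , q<r) _ (inj₂ (inj₂ refl)) _ = inj₂ (ℕ.<⇒≤ q<r)
  ≥middle _ _ (inj₂ (inj₁ refl)) _ = inj₂ ℕ.≤-refl
  ≥middle _ (inj₁ refl) (inj₁ refl) x≢y = contradiction refl x≢y
  red⇒< : ∀ e → col e ≡ true → toℕ (middle e) < a
  red⇒< e = does-true (toℕ (middle e) <? a)
  blue⇒≥ : ∀ e → col e ≡ false → a ≤ toℕ (middle e)
  blue⇒≥ e = ℕ.≮⇒≥ ∘ does-false (toℕ (middle e) <? a)
  ¬red : ¬ MonoBergeK (a + b) col true (2 + a)
  ¬red K@(φ , ψ , φ-inj , _ , _ , colψ) =
    avoid-bound (λ x → toℕ x <? a) (λ lt → fromℕ< lt)
      (λ p q eq → Fin.toℕ-injective (Fin.fromℕ<-injective _ _ p q eq)) φ φ-inj cover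
    where
    cover : ∀ {i j} → i ≢ j → toℕ (φ i) < a ⊎ toℕ (φ j) < a
    cover {i} {j} i≢j with p , i∈ , j∈ ← pair-⊆ {col = col} K i≢j =
      Sum.map (λ le → ℕ.≤-<-trans le (red⇒< (ψ p) (colψ p))) (λ le → ℕ.≤-<-trans le (red⇒< (ψ p) (colψ p)))
        (≤middle (ψ p) i∈ j∈ (i≢j ∘ φ-inj i j))
  ¬blue : ¬ MonoBergeK (a + b) col false (2 + b)
  ¬blue K@(φ , ψ , φ-inj , _ , _ , colψ) =
    avoid-bound (λ x → a ℕ.≤? toℕ x) (λ {x} le → fromℕ< (bound x le))
      (λ {x} {y} p q eq → Fin.toℕ-injective
        (ℕ.∸-cancelʳ-≡ p q (Fin.fromℕ<-injective _ _ (bound x p) (bound y q) eq)))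
      φ φ-inj cover
    where
    bound : ∀ (x : Fin (a + b)) → a ≤ toℕ x → toℕ x ∸ a < b
    bound x le = subst (toℕ x ∸ a <_) (ℕ.m+n∸m≡n a b) (ℕ.∸-monoˡ-< (Fin.toℕ<n x) le)
    cover : ∀ {i j} → i ≢ j → a ≤ toℕ (φ i) ⊎ a ≤ toℕ (φ j)
    cover {i} {j} i≢j with p , i∈ , j∈ ← pair-⊆ {col = col} K i≢j =
      Sum.map (ℕ.≤-trans (blue⇒≥ (ψ p) (colψ p))) (ℕ.≤-trans (blue⇒≥ (ψ p) (colψ p)))
        (≥middle (ψ p) i∈ j∈ (i≢j ∘ φ-inj i j))

¬arrows-2-t : ∀ n → ¬ Arrows n 2 (suc n)
¬arrows-2-t n arr = [ ¬red , ¬blue ]′ (arr λ _ → false)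
  where
  ¬red : ¬ MonoBergeK n (λ _ → false) true 2
  ¬red (_ , _ , _ , _ , _ , colψ) = contradiction (colψ ((0F , 1F) , s≤s z≤n)) λ ()
  ¬blue : ¬ MonoBergeK n (λ _ → false) false (suc n)
  ¬blue (φ , _ , φ-inj , _) = Fin.<⇒notInjective {f = φ} (ℕ.n<1+n n) (φ-inj _ _)

inj⇒onto : ∀ {n} (φ : Fin n → Fin n) → Inj φ → ∀ b → ∃[ i ] φ i ≡ b
inj⇒onto {suc n} φ φ-inj b = decidable-stable (any? λ i → φ i ≟ b) λ none →
  Fin.<⇒notInjective (ℕ.n<1+n n) λ {i} {j} eq →
    φ-inj i j (Fin.punchOut-injective {i = b} (λ b≡ → none (i , sym b≡)) (λ b≡ → none (j , sym b≡)) eq)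

-- A vertex other than 0 and 1 lies in one red triple only, but a core vertex of a Berge K₃ lies in
-- two hyperedges, so a red core would fit into {0, 1}. A blue core is the whole vertex set, and its
-- pair {0, 1} lies in no blue triple.
¬arrows-3-t : ∀ n → ¬ Arrows (2 + n) 3 (2 + n)
¬arrows-3-t n arr = [ ¬red , ¬blue ]′ (arr col)
  where
  -- In a sorted triple containing 0 and 1, these are the first two entries.
  isPair : Fin (2 + n) → Fin (2 + n) → Bool
  isPair 0F 1F = true
  isPair _  _  = false
  col : Colouring (2 + n)
  col ((a , b , _) , _) = isPair a b
  red⇒ : ∀ a b → isPair a b ≡ true → a ≡ 0F × b ≡ 1F
  red⇒ 0F 1F _ = refl , refl
  red-at : ∀ e {x} → col e ≡ true → x ∈ₑ e → x ≢ 0F → x ≢ 1F → proj₁ e ≡ (0F , 1F , x)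
  red-at ((a , b , c) , _) ce x∈ x≢0 x≢1 with refl , refl ← red⇒ a b ce with x∈
  ... | inj₁ x≡0        = contradiction x≡0 x≢0
  ... | inj₂ (inj₁ x≡1) = contradiction x≡1 x≢1
  ... | inj₂ (inj₂ refl) = refl
  ¬red : ¬ MonoBergeK (2 + n) col true 3
  ¬red (φ , ψ , φ-inj , ψ-inj , ⊆ψ , colψ) = three (low 0F) (low 1F) (low 2F)
    where
    01< : Pair 3
    01< = (0F , 1F) , s≤s z≤n
    02< : Pair 3
    02< = (0F , 2F) , s≤s z≤n
    12< : Pair 3
    12< = (1F , 2F) , s≤s (s≤s z≤n)
    repeated : ∀ p q {x} → x ∈ₑ ψ p → x ∈ₑ ψ q → proj₁ p ≢ proj₁ q → x ≡ 0F ⊎ x ≡ 1F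
    repeated p q {x} x∈p x∈q p≢q with x ≟ 0F | x ≟ 1F
    ... | yes eq | _ = inj₁ eq
    ... | no _ | yes eq = inj₂ eq
    ... | no x≢0 | no x≢1 = contradiction (ψ-inj p q (trans (red-at (ψ p) (colψ p) x∈p x≢0 x≢1)
                              (sym (red-at (ψ q) (colψ q) x∈q x≢0 x≢1)))) p≢q
    low : ∀ i → φ i ≡ 0F ⊎ φ i ≡ 1F
    low 0F = repeated 01< 02< (proj₁ (⊆ψ 01<)) (proj₁ (⊆ψ 02<)) λ ()
    low 1F = repeated 01< 12< (proj₂ (⊆ψ 01<)) (proj₁ (⊆ψ 12<)) λ ()
    low 2F = repeated 02< 12< (proj₂ (⊆ψ 02<)) (proj₂ (⊆ψ 12<)) λ ()
    same : ∀ {i j x} → φ i ≡ x → φ j ≡ x → i ≢ j → ⊥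
    same p q i≢j = i≢j (φ-inj _ _ (trans p (sym q)))
    three : φ 0F ≡ 0F ⊎ φ 0F ≡ 1F → φ 1F ≡ 0F ⊎ φ 1F ≡ 1F → φ 2F ≡ 0F ⊎ φ 2F ≡ 1F → ⊥
    three (inj₁ p) (inj₁ q) _        = same p q λ ()
    three (inj₂ p) (inj₂ q) _        = same p q λ ()
    three (inj₁ p) (inj₂ _) (inj₁ r) = same p r λ ()
    three (inj₂ p) (inj₁ _) (inj₂ r) = same p r λ ()
    three (inj₁ _) (inj₂ q) (inj₂ r) = same q r λ ()
    three (inj₂ _) (inj₁ q) (inj₁ r) = same q r λ ()
  both⇒red : ∀ e → 0F ∈ₑ e → 1F ∈ₑ e → col e ≡ true
  both⇒red (_ , a<b , _)   (inj₁ refl)        (inj₂ (inj₁ refl)) = refl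
  both⇒red (_ , a<b , b<c) (inj₁ refl)        (inj₂ (inj₂ refl)) = contradiction (ℕ.<-≤-trans a<b (s≤s⁻¹ b<c)) λ ()
  both⇒red (_ , () , _)    (inj₂ (inj₁ refl)) _
  both⇒red (_ , _ , ())    (inj₂ (inj₂ refl)) _
  ¬blue : ¬ MonoBergeK (2 + n) col false (2 + n)
  ¬blue K@(φ , ψ , φ-inj , _ , _ , colψ)
    with i , φi≡0 ← inj⇒onto φ φ-inj 0F | j , φj≡1 ← inj⇒onto φ φ-inj 1F
    with p , i∈ , j∈ ← pair-⊆ {col = col} K {i} {j} (λ { refl → contradiction (trans (sym φi≡0) φj≡1) λ () })
    with () ← trans (sym (colψ p)) (both⇒red (ψ p) (subst (_∈ₑ ψ p) φi≡0 i∈) (subst (_∈ₑ ψ p) φj≡1 j∈))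

pairs : ∀ k → List (Pair k)
pairs zero    = []
pairs (suc k) = List.tabulate (λ j → (zero , suc j) , s≤s z≤n) ++ List.map up (pairs k)

-- The hyperedges of a copy inject the pairs of K_k into `es`. That `pairs k` has no repetition is
-- left as a hypothesis, to be decided for each numeral `k`.
few⇒¬berge : ∀ {col : Colouring N} (es : List (Tri (Fin N))) → (∀ e → col e ≡ κ → proj₁ e ∈ₗ es) →
  (∀ i j → proj₁ (List.lookup (pairs k) i) ≡ proj₁ (List.lookup (pairs k) j) → i ≡ j) →
  length es < length (pairs k) → ¬ MonoBergeK N col κ k
few⇒¬berge {k = k} es all pairs-inj few (_ , ψ , _ , ψ-inj , _ , colψ)
  with i , j , i<j , eq ← pigeonhole few (λ i → Any.index (all (ψ (List.lookup (pairs k) i)) (colψ _)))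
  = Fin.<⇒≢ i<j (pairs-inj i j (ψ-inj _ _ (trans (Any.lookup-index (all (ψ (List.lookup (pairs k) i)) (colψ _)))
      (trans (cong (List.lookup es) eq) (sym (Any.lookup-index (all (ψ (List.lookup (pairs k) j)) (colψ _))))))))

_≟₃_ : ∀ (t u : Tri (Fin N)) → Dec (t ≡ u)
_≟₃_ = Product.≡-dec _≟_ (Product.≡-dec _≟_ _≟_)

module _ {N s t : ℕ} (reds blues : List (Tri (Fin N))) where
  open DecMembership (_≟₃_ {N}) using () renaming (_∈?_ to _∈ₗ?_)

  Small : Set
  Small =
    (∀ a b c → a <ᶠ b → b <ᶠ c → (a , b , c) ∈ₗ reds ⊎ (a , b , c) ∈ₗ blues) ×
    (∀ i j → proj₁ (List.lookup (pairs s) i) ≡ proj₁ (List.lookup (pairs s) j) → i ≡ j) ×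
    (∀ i j → proj₁ (List.lookup (pairs t) i) ≡ proj₁ (List.lookup (pairs t) j) → i ≡ j) ×
    length reds < length (pairs s) × length blues < length (pairs t)

  small? : Dec Small
  small? =
    all? (λ a → all? λ b → all? λ c → (a Fin.<? b) →-dec ((b Fin.<? c) →-dec
      (((a , b , c) ∈ₗ? reds) ⊎-dec ((a , b , c) ∈ₗ? blues)))) ×-dec
    all? (λ i → all? λ j → (Product.≡-dec _≟_ _≟_ _ _) →-dec (i ≟ j)) ×-dec
    all? (λ i → all? λ j → (Product.≡-dec _≟_ _≟_ _ _) →-dec (i ≟ j)) ×-dec
    (length reds <? length (pairs s)) ×-dec (length blues <? length (pairs t))

  ¬arrows-small : {True small?} → ¬ Arrows N s t
  ¬arrows-small {ok} arr with cover , s-inj , t-inj , s-few , t-few ← toWitness ok =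
    [ few⇒¬berge {col = col} reds isRed s-inj s-few
    , few⇒¬berge {col = col} blues (isBlue cover) t-inj t-few ]′ (arr col)
    where
    col : Colouring N
    col e = does (proj₁ e ∈ₗ? reds)
    isRed : ∀ e → col e ≡ true → proj₁ e ∈ₗ reds
    isRed e = does-true (proj₁ e ∈ₗ? reds)
    isBlue : (∀ a b c → a <ᶠ b → b <ᶠ c → (a , b , c) ∈ₗ reds ⊎ (a , b , c) ∈ₗ blues) →
      ∀ e → col e ≡ false → proj₁ e ∈ₗ blues
    isBlue cover e@((a , b , c) , a<b , b<c) ce =
      [ (λ e∈ → contradiction e∈ (does-false (proj₁ e ∈ₗ? reds) ce)) , id ]′ (cover a b c a<b b<c)

-- Exact values

-- By monotonicity only the predecessor needs a counterexample.
exactly : ∀ {M} → Arrows (suc M) s t → ¬ Arrows M s t → RamseyBergeK3 s t (suc M)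
exactly arr ¬arr = arr , λ M′ M′<1+M arr′ → ¬arr (arrows-≤ (s≤s⁻¹ M′<1+M) arr′)

ramsey-sym : RamseyBergeK3 s t N → RamseyBergeK3 t s N
ramsey-sym (arr , min) = arrows-sym arr , λ M M<N arr′ → min M M<N (arrows-sym arr′)

-- The values at (2, 4), (3, 3), (4, 4) equal those at (2, 5), (3, 4), (4, 5), so the upper bounds
-- carry over.
dropBlue : Arrows N s (suc t) → Arrows N s t
dropBlue arr col = Sum.map₂ (dropVertex {col = col}) (arr col)

ramsey-2-2 : RamseyBergeK3 2 2 3
ramsey-2-2 = exactly arrows-3-2-2 (¬arrows-small [] [])

ramsey-2-3 : RamseyBergeK3 2 3 4
ramsey-2-3 = exactly arrows-4-2-3 (¬arrows-small [] (List.map triple (213 ∷ [])))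

ramsey-2-4 : RamseyBergeK3 2 4 5
ramsey-2-4 = exactly (dropBlue arrows-5-2-5) (¬arrows-small [] (List.map triple (214 ∷ 314 ∷ 324 ∷ 321 ∷ [])))

ramsey-3-3 : RamseyBergeK3 3 3 5
ramsey-3-3 = exactly (dropBlue arrows-5-3-4)
  (¬arrows-small (List.map triple (214 ∷ 314 ∷ [])) (List.map triple (324 ∷ 321 ∷ [])))

-- The ten triples on five vertices split into five and five, one fewer than the six pairs of K₄.
ramsey-4-4 : RamseyBergeK3 4 4 6
ramsey-4-4 = exactly (dropBlue arrows-6-4-5)
  (¬arrows-small (List.map triple (215 ∷ 315 ∷ 415 ∷ 325 ∷ 425 ∷ []))
                 (List.map triple (435 ∷ 321 ∷ 421 ∷ 431 ∷ 432 ∷ [])))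

ramsey-2-t : ∀ j → RamseyBergeK3 2 (5 + j) (5 + j + 2 ∸ 2)
ramsey-2-t j = subst (RamseyBergeK3 2 (5 + j)) (sym (ℕ.m+n∸n≡m (5 + j) 2))
  (exactly (arrows-2-t j) (¬arrows-2-t (4 + j)))

ramsey-3-t : ∀ j → RamseyBergeK3 3 (4 + j) (4 + j + 3 ∸ 2)
ramsey-3-t j = subst (RamseyBergeK3 3 (4 + j)) (cong (2 +_) (ℕ.+-comm 3 j))
  (exactly (arrows-3-t j) (¬arrows-3-t (2 + j)))

ramsey-s-t : ∀ i j → RamseyBergeK3 (4 + i) (5 + j) (5 + j + (4 + i) ∸ 3)
ramsey-s-t i j = subst (RamseyBergeK3 (4 + i) (5 + j)) (cong (2 +_) (ℕ.+-comm (4 + i) j))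
  (exactly (arrows-s-t i j) (subst (λ M → ¬ Arrows M (4 + i) (5 + j)) size (¬arrows-threshold (2 + i) (3 + j))))
  where
  size : 2 + i + (3 + j) ≡ 5 + i + j
  size = trans (ℕ.+-comm (2 + i) (3 + j)) (cong (3 +_) (ℕ.+-comm j (2 + i)))

theorem1p5 : (s t : ℕ) → 2 ≤ s → 2 ≤ t →
    (((s ≡ 2 × t ≡ 2) ⊎ (s ≡ 3 × t ≡ 3) ⊎ (s ≡ 2 × t ≡ 3) ⊎ (s ≡ 3 × t ≡ 2)
    ⊎ (s ≡ 2 × t ≡ 4) ⊎ (s ≡ 4 × t ≡ 2)) → RamseyBergeK3 s t (t + s ∸ 1))
    × (((s ≡ 2 × 5 ≤ t) ⊎ (s ≡ 3 × 4 ≤ t) ⊎ (s ≡ 4 × t ≡ 4)) → RamseyBergeK3 s t (t + s ∸ 2))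
    × ((4 ≤ s × 5 ≤ t) → RamseyBergeK3 s t (t + s ∸ 3))
theorem1p5 s t _ _ = small , medium , large
  where
  small : (s ≡ 2 × t ≡ 2) ⊎ (s ≡ 3 × t ≡ 3) ⊎ (s ≡ 2 × t ≡ 3) ⊎ (s ≡ 3 × t ≡ 2)
    ⊎ (s ≡ 2 × t ≡ 4) ⊎ (s ≡ 4 × t ≡ 2) → RamseyBergeK3 s t (t + s ∸ 1)
  small (inj₁ (refl , refl))                             = ramsey-2-2
  small (inj₂ (inj₁ (refl , refl)))                      = ramsey-3-3
  small (inj₂ (inj₂ (inj₁ (refl , refl))))               = ramsey-2-3
  small (inj₂ (inj₂ (inj₂ (inj₁ (refl , refl)))))        = ramsey-sym ramsey-2-3
  small (inj₂ (inj₂ (inj₂ (inj₂ (inj₁ (refl , refl)))))) = ramsey-2-4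
  small (inj₂ (inj₂ (inj₂ (inj₂ (inj₂ (refl , refl)))))) = ramsey-sym ramsey-2-4
  medium : (s ≡ 2 × 5 ≤ t) ⊎ (s ≡ 3 × 4 ≤ t) ⊎ (s ≡ 4 × t ≡ 4) → RamseyBergeK3 s t (t + s ∸ 2)
  medium (inj₁ (refl , 5≤t)) with j , refl ← ℕ.m≤n⇒∃[o]m+o≡n 5≤t = ramsey-2-t j
  medium (inj₂ (inj₁ (refl , 4≤t))) with j , refl ← ℕ.m≤n⇒∃[o]m+o≡n 4≤t = ramsey-3-t j
  medium (inj₂ (inj₂ (refl , refl))) = ramsey-4-4
  large : 4 ≤ s × 5 ≤ t → RamseyBergeK3 s t (t + s ∸ 3)
  large (4≤s , 5≤t) with i , refl ← ℕ.m≤n⇒∃[o]m+o≡n 4≤s | j , refl ← ℕ.m≤n⇒∃[o]m+o≡n 5≤t = ramsey-s-t i j
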